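{- Let $s,t$ be integers with $t\neq 0$. Then there do not exist a positive integer $l$ and polynomials $G_0(X),G_1(X),\ldots,G_l(X)\in\mathbb Q[X]$ such that \[ P_n(s,t)=G_0(n)+\sum_{j=1}^l G_j(n)\,P_{n-j}(s,t) \] for all sufficiently large positive integers $n$, where $P_n(s,t)$ denotes the $n$-th Lucas atom evaluated at $(s,t)$.
   Context: Lucas atoms: for $n\ge 1$ let $\Phi_n(\alpha,\beta)=\prod_{1\le j\le n,\ \gcd(j,n)=1}(\alpha-\omega^j\beta)$, with $\omega$ a primitive $n$-th root of unity (the homogenization of the $n$-th cyclotomic polynomial). Put $P_1(s,t)=1$, and for $n\ge 2$ let $P_n(s,t)\in\mathbb Z[s,t]$ be the unique polynomial with $P_n(\alpha+\beta,-\alpha\beta)=\Phi_n(\alpha,\beta)$ as polynomials in the variables $\alpha,\beta$. -}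

module Defs where

open import Algebra.Apartness.Bundles using (HeytingField; HeytingCommutativeRing)
open import Algebra.Bundles using (CommutativeRing; RawRing)
import Algebra.Definitions.RawSemiring as RawSemiringDefs
open import Data.Fin.Base using (Fin; zero; suc; toℕ)
open import Data.Integer.Base as ℤ using (ℤ; +_; -[1+_])
open import Data.List.Base using (List; []; _∷_; map; foldr; filter; upTo)
open import Data.Nat.Base as ℕ using (ℕ; zero; suc)
open import Data.Nat.GCD using (gcd)
open import Data.Nat.Properties using (_≟_)
open import Data.Product.Base using (_×_)
open import Data.Rational.Base as ℚ using (ℚ)
open import Relation.Nullary.Negation using (¬_)

-- Univariate polynomials over a ring are lists of coefficients, constant term
-- first.  Trailing zeros are allowed; the equality compares coefficients and
-- so ignores them.

module _ {c ℓ} (R : RawRing c ℓ) where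
  open RawRing R

  coeff : List Carrier → ℕ → Carrier
  coeff []      _       = 0#
  coeff (a ∷ _) zero    = a
  coeff (_ ∷ f) (suc i) = coeff f i

  addPoly : List Carrier → List Carrier → List Carrier
  addPoly []      g       = g
  addPoly f       []      = f
  addPoly (a ∷ f) (b ∷ g) = (a + b) ∷ addPoly f g

  mulPoly : List Carrier → List Carrier → List Carrier
  mulPoly []      g = []
  mulPoly (a ∷ f) g = addPoly (map (a *_) g) (0# ∷ mulPoly f g)

  infixl 10 _[X]

  _[X] : RawRing c ℓ
  _[X] = record
    { Carrier = List Carrier
    ; _≈_     = λ f g → ∀ i → coeff f i ≈ coeff g i
    ; _+_     = addPoly
    ; _*_     = mulPoly
    ; -_      = map (-_)
    ; 0#      = []
    ; 1#      = 1# ∷ []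
    }

  const : Carrier → List Carrier
  const a = a ∷ []

  var : List Carrier
  var = 0# ∷ 1# ∷ []

  fromℤ : ℤ → Carrier
  fromℤ (+ n)    = RawSemiringDefs._×_ rawSemiring n 1#
  fromℤ -[1+ n ] = - (RawSemiringDefs._×_ rawSemiring (suc n) 1#)

  -- Evaluation by Horner's rule, with coefficients mapped into the ring by ι.
  eval : ∀ {a} {A : Set a} (ι : A → Carrier) → List A → Carrier → Carrier
  eval ι f x = foldr (λ b r → ι b + x * r) 0# f

  -- The entries of the outer list are polynomials in the first variable.
  eval₂ : ∀ {a} {A : Set a} (ι : A → Carrier) →
          List (List A) → Carrier → Carrier → Carrier
  eval₂ ι f x y = eval (λ g → eval ι g x) f y

ℤ[s,t] : RawRing _ _
ℤ[s,t] = ℤ.+-*-rawRing [X] [X]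

-- The homogenised cyclotomic polynomial Φₙ(α,β), in R[α][β], built from an
-- element ω of R that is intended to be a primitive n-th root of unity.

module Cyclotomic {c ℓ} (R : RawRing c ℓ) where
  private module R = RawRing R

  R[α,β] : RawRing c ℓ
  R[α,β] = R [X] [X]

  open RawRing R[α,β] public

  α β : Carrier
  α = const (R [X]) (var R)
  β = var (R [X])

  scalar : R.Carrier → Carrier
  scalar a = const (R [X]) (const R a)

  totatives : ℕ → List ℕ
  totatives n = filter (λ j → gcd j n ≟ 1) (map suc (upTo n))

  Φ : ℕ → R.Carrier → Carrier
  Φ n ω = foldr _*_ 1# (map (λ j → α - scalar (ω ^ j) * β) (totatives n))
    where
    open RawSemiringDefs R.rawSemiring using (_^_)
    infixl 6 _-_
    _-_ : Carrier → Carrier → Carrier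
    f - g = f + (- g)

-- The library has no ℂ; K is any field of characteristic zero with primitive
-- roots of unity of every order (ω n below has order n), for instance ℂ or the
-- field generated over ℚ by all roots of unity.

module _ {c ℓ₁ ℓ₂} (K : HeytingField c ℓ₁ ℓ₂) where
  private
    module K = HeytingField K

    rawRing : RawRing c ℓ₁
    rawRing = CommutativeRing.rawRing
      (HeytingCommutativeRing.commutativeRing K.heytingCommutativeRing)

  open RawSemiringDefs (RawRing.rawSemiring rawRing) using (_^_) renaming (_×_ to _·_)

  CharacteristicZero : Set ℓ₁
  CharacteristicZero = ∀ n → 1 ℕ.≤ n → ¬ (n · K.1# K.≈ K.0#)

  IsPrimitiveRoot : ℕ → K.Carrier → Set ℓ₁
  IsPrimitiveRoot n ω =
    ω ^ n K.≈ K.1# × (∀ k → 1 ℕ.≤ k → k ℕ.< n → ¬ (ω ^ k K.≈ K.1#))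

  -- This determines P n up to the equality of ℤ[s,t] for every n ≥ 1, whatever
  -- the choice of K and ω; P 0 is unconstrained.
  IsLucasAtoms : (ω : ℕ → K.Carrier) (P : ℕ → RawRing.Carrier ℤ[s,t]) → Set ℓ₁
  IsLucasAtoms ω P =
    P 1 ≈ℤ[s,t] 1ℤ[s,t] ×
    (∀ n → 2 ℕ.≤ n → eval₂ R[α,β] (fromℤ R[α,β]) (P n) (α + β) (- (α * β)) ≈ Φ n (ω n))
    where
    open Cyclotomic rawRing
    open RawRing ℤ[s,t] using () renaming (_≈_ to _≈ℤ[s,t]_; 1# to 1ℤ[s,t])

evalℤ[s,t] : RawRing.Carrier ℤ[s,t] → ℤ → ℤ → ℤ
evalℤ[s,t] = eval₂ ℤ.+-*-rawRing (λ a → a)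

ℚ[X] : RawRing _ _
ℚ[X] = ℚ.+-*-rawRing [X]

evalℚ[X] : RawRing.Carrier ℚ[X] → ℚ → ℚ
evalℚ[X] = eval ℚ.+-*-rawRing (λ a → a)

ℤ→ℚ : ℤ → ℚ
ℤ→ℚ a = a ℚ./ 1

ℕ→ℚ : ℕ → ℚ
ℕ→ℚ n = ℤ→ℚ (+ n)

-- G₀(n) + Σ_{j=1}^{l} Gⱼ(n) u(n - j).  The index i : Fin l stands for
-- j = i + 1; the truncated subtraction is exact when l ≤ n.
recurrenceRHS : (u : ℕ → ℤ) (l : ℕ) (G : Fin (suc l) → RawRing.Carrier ℚ[X]) → ℕ → ℚ
recurrenceRHS u l G n =
  evalℚ[X] (G zero) (ℕ→ℚ n) ℚ.+
  sum (λ (i : Fin l) → evalℚ[X] (G (suc i)) (ℕ→ℚ n) ℚ.* ℤ→ℚ (u (n ℕ.∸ toℕ (suc i))))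
  where open RawSemiringDefs (RawRing.rawSemiring ℚ.+-*-rawRing) using (sum)

module Submission where

-- Write u(n) = Pₙ(s,t).  Clearing denominators in the recurrence gives some
-- D ≥ 1 such that u mod p is eventually periodic for every prime p ∤ D.
-- Choose such a p, also prime to t, for which X² - s X - t splits modulo p;
-- lifting its roots to natural numbers a > b prime to p, u(n) ≡ Φₙ(a,b) for
-- n ≥ 2, and the product of Φ_d(a,b) over d ∣ n is aⁿ - bⁿ.  If p ∣ Φₙ(a,b)
-- and p ∤ q, then p ∤ Φ_{nq}(a,b), because Φ_{nq}(a,b) divides
-- (a^{nq} - b^{nq}) / (aⁿ - bⁿ) ≡ q a^{n(q-1)}.  With q = p this quotient is
-- divisible by p, which yields zeros modulo p of arbitrarily large index.  A
-- large zero n and a period T contradict the former with q = 1 + p T, since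
-- n q = n + (n p) T is again a zero.

open import Defs
open import Algebra.Apartness.Bundles using (HeytingField; HeytingCommutativeRing)
open import Algebra.Bundles using (CommutativeRing; RawRing)
import Algebra.Definitions.RawSemiring as RawSemiringDefs
open import Algebra.Morphism.Structures using (module RingMorphisms)
import Algebra.Properties.CommutativeSemigroup as CommutativeSemigroupProperties
import Algebra.Properties.Group as GroupProperties
import Algebra.Properties.Ring as RingProperties
import Algebra.Properties.Semiring.Exp as SemiringExp
import Algebra.Properties.Semiring.Mult as SemiringMult
open import Data.Empty using (⊥-elim)
open import Data.Fin.Base using (Fin; zero; suc; toℕ; fromℕ<; funToFin; finToFun)
open import Data.Fin.Properties using (pigeonhole; fromℕ<-injective; finToFun-funToFin; toℕ<n; toℕ-fromℕ<)
open import Data.Integer.Base as ℤ using (ℤ; +_; -[1+_]; 0ℤ; 1ℤ)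
open import Data.Integer.Divisibility.Signed
  using (_∣_; divides; ∣ᵤ⇒∣; ∣⇒∣ᵤ; ∣m∣n⇒∣m+n; ∣m⇒∣-m; ∣m∣n⇒∣m-n; ∣n⇒∣m*n; ∣m⇒∣m*n; ∣-trans)
open import Data.Integer.DivMod using (_%ℕ_; _/ℕ_; n%ℕd<d; a≡a%ℕn+[a/ℕn]*n)
import Data.Integer.Properties as ℤₚ
open import Data.Integer.Tactic.RingSolver using (solve-∀)
open import Data.List.Base using (List; []; _∷_; _++_; map; foldr; length; replicate; filter; upTo; concatMap)
open import Data.List.Membership.Propositional using (_∈_; find; lose)
open import Data.List.Membership.Propositional.Properties
  using (∈-map⁺; ∈-map⁻; ∈-filter⁺; ∈-filter⁻; ∈-upTo⁺; ∈-upTo⁻; ∈-concatMap⁺; ∈-concatMap⁻)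
open import Data.List.Membership.Propositional.Properties.WithK using (unique∧set⇒bag)
import Data.List.Properties as Listₚ
open import Data.List.Relation.Binary.BagAndSetEquality using (_∼[_]_; set; ∼bag⇒↭)
open import Data.List.Relation.Binary.Disjoint.Propositional using (Disjoint)
open import Data.List.Relation.Binary.Permutation.Propositional.Properties using (↭-length)
open import Data.List.Relation.Unary.All as All using (All; []; _∷_)
import Data.List.Relation.Unary.All.Properties as Allₚ
open import Data.List.Relation.Unary.AllPairs as AllPairs using (AllPairs; []; _∷_)
import Data.List.Relation.Unary.AllPairs.Properties as AllPairsₚ
open import Data.List.Relation.Unary.Any using (here; there)
open import Data.List.Relation.Unary.Unique.Propositional using (Unique)
import Data.List.Relation.Unary.Unique.Propositional.Properties as Uniqueₚ
open import Data.Nat.Base as ℕ using (ℕ; zero; suc; _≤_; _<_; z≤n; s≤s; NonZero; ≢-nonZero; >-nonZero)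
open import Data.Nat.Coprimality as Coprimality using (Coprime; gcd≡1⇒coprime; coprime-divisor)
open import Data.Nat.DivMod using (_%_; _/_; m/n*n≡m; m≡m%n+[m/n]*n; m%n<n)
import Data.Nat.Divisibility as ℕ∣
open import Data.Nat.GCD using (gcd; gcd[m,n]∣m; gcd[m,n]∣n; gcd[m,n]≢0; c*gcd[m,n]≡gcd[cm,cn])
open import Data.Nat.Induction using (<-rec)
open import Data.Nat.Primality using (Prime; euclidsLemma; prime⇒nonZero; prime⇒nonTrivial; prime⇒irreducible; ¬prime[1])
open import Data.Nat.Primality.Factorisation using (factorise)
import Data.Nat.Properties as ℕₚ
open import Data.Product.Base using (_×_; _,_; proj₁; proj₂; ∃-syntax; Σ-syntax)
open import Data.Rational.Base as ℚ using (ℚ; ↥_; ↧_; ↧ₙ_; toℚᵘ)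
import Data.Rational.Properties as ℚₚ
open import Data.Rational.Solver using (module +-*-Solver)
open import Data.Rational.Unnormalised.Base as ℚᵘ using (mkℚᵘ; *≡*)
import Data.Rational.Unnormalised.Properties as ℚᵘₚ
open import Data.Sum.Base as Sum using (_⊎_; inj₁; inj₂)
open import Function.Base using (_∘_)
open import Function.Bundles using (mk⇔)
open import Relation.Binary.Bundles using (Setoid)
open import Relation.Binary.PropositionalEquality as ≡ using (_≡_; _≢_)
import Relation.Binary.Reasoning.Setoid as SetoidReasoning
open import Relation.Nullary.Decidable using (Dec; yes; no; _×-dec_; ¬?)
open import Relation.Nullary.Negation using (¬_; contradiction)

-- Evaluation homomorphisms

-- The quotient of a^(nq) - b^(nq) by aⁿ - bⁿ is needed exactly where aⁿ - bⁿ vanishes modulo p, so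
-- it has to be formed in ℤ and reduced afterwards. Hence the roots modulo p are lifted to distinct
-- natural numbers a > b: then aⁿ ≠ bⁿ for every n ≥ 1, even if X² - s X - t has a double root or
-- its roots have a root of unity as their ratio. Asking that the quadratic split modulo p keeps
-- these lifts in ℤ instead of a quadratic extension. The product formula is proved in K, where the
-- cyclotomic factors are linear, and descends to ℤ because K has characteristic zero.

IsRingHom : ∀ {a ℓ₁ b ℓ₂} (S : RawRing a ℓ₁) (R : CommutativeRing b ℓ₂) →
            (RawRing.Carrier S → CommutativeRing.Carrier R) → Set _
IsRingHom S R = RingMorphisms.IsRingHomomorphism S (CommutativeRing.rawRing R)

module _ {a ℓ₁ b ℓ₂} {S : RawRing a ℓ₁} {R : CommutativeRing b ℓ₂}
         {ι : RawRing.Carrier S → CommutativeRing.Carrier R} where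
  private
    module S = RawRing S
    module R = CommutativeRing R

  mkRingHom : (∀ {x y} → x S.≈ y → ι x R.≈ ι y) →
              (∀ x y → ι (x S.+ y) R.≈ ι x R.+ ι y) → ι S.0# R.≈ R.0# →
              (∀ x y → ι (x S.* y) R.≈ ι x R.* ι y) → ι S.1# R.≈ R.1# →
              (∀ x → ι (S.- x) R.≈ R.- ι x) → IsRingHom S R ι
  mkRingHom cong +-homo 0-homo *-homo 1-homo neg-homo = record
    { isSemiringHomomorphism = record
      { isNearSemiringHomomorphism = record
        { +-isMonoidHomomorphism = record
          { isMagmaHomomorphism = record
            { isRelHomomorphism = record { cong = cong } ; homo = +-homo }
          ; ε-homo = 0-homo
          }
        ; *-homo = *-homo
        }
      ; 1#-homo = 1-homo
      }
    ; -‿homo = neg-homo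
    }

module _ {b ℓ} (R : CommutativeRing b ℓ) where
  open CommutativeRing R

  eval-cong : ∀ {a} {A : Set a} {ι κ : A → Carrier} → (∀ z → ι z ≈ κ z) →
              ∀ f {x y} → x ≈ y → eval rawRing ι f x ≈ eval rawRing κ f y
  eval-cong ι≈κ []      x≈y = refl
  eval-cong ι≈κ (c ∷ f) x≈y = +-cong (ι≈κ c) (*-cong x≈y (eval-cong ι≈κ f x≈y))

module _ {a ℓ₁ b ℓ₂} {S : RawRing a ℓ₁} (R : CommutativeRing b ℓ₂)
         {h : RawRing.Carrier S → CommutativeRing.Carrier R} (isHom : IsRingHom S R h) where
  private
    module S = RawRing S
  open CommutativeRing R
  open RingMorphisms.IsRingHomomorphism isHom

  eval-natural : ∀ {c} {A : Set c} (ι : A → S.Carrier) f x →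
                 h (eval S ι f x) ≈ eval rawRing (λ z → h (ι z)) f (h x)
  eval-natural ι []      x = 0#-homo
  eval-natural ι (c ∷ f) x = trans (+-homo _ _) (+-congˡ (trans (*-homo _ _) (*-congˡ (eval-natural ι f x))))

  eval₂-natural : ∀ {c} {A : Set c} (ι : A → S.Carrier) f x y →
                  h (eval₂ S ι f x y) ≈ eval₂ rawRing (λ z → h (ι z)) f (h x) (h y)
  eval₂-natural ι f x y =
    trans (eval-natural _ f y) (eval-cong R (λ g → eval-natural ι g x) f refl)

  ×1-natural : ∀ n → h (RawSemiringDefs._×_ S.rawSemiring n S.1#)
                   ≈ RawSemiringDefs._×_ (RawRing.rawSemiring rawRing) n 1#
  ×1-natural zero    = 0#-homo
  ×1-natural (suc n) = trans (+-homo _ _) (+-cong 1#-homo (×1-natural n))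

  fromℤ-natural : ∀ z → h (fromℤ S z) ≈ fromℤ rawRing z
  fromℤ-natural (+ n)    = ×1-natural n
  fromℤ-natural -[1+ n ] = trans (-‿homo _) (-‿cong (×1-natural (suc n)))

  module _ (x : Carrier) where
    private
      ev : List S.Carrier → Carrier
      ev f = eval rawRing h f x
    open SetoidReasoning setoid
    open RingProperties ring using (-‿distribʳ-*; -‿+-comm; -0#≈0#)
    open CommutativeSemigroupProperties +-commutativeSemigroup using (interchange)
    open CommutativeSemigroupProperties *-commutativeSemigroup using (x∙yz≈y∙xz)

    private
      -- Lists of different lengths can be equal as polynomials; this disposes of the surplus
      -- coefficients, which are then equal to zero.
      ev-zero : ∀ f → (∀ i → coeff S f i S.≈ S.0#) → ev f ≈ 0#
      ev-zero []      f≈0 = refl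
      ev-zero (c ∷ f) f≈0 = begin
        h c + x * ev f ≈⟨ +-cong (trans (⟦⟧-cong (f≈0 0)) 0#-homo) (*-congˡ (ev-zero f λ i → f≈0 (suc i))) ⟩
        0# + x * 0#    ≈⟨ trans (+-identityˡ _) (zeroʳ x) ⟩
        0#             ∎

      ev-cong : ∀ f g → (∀ i → coeff S f i S.≈ coeff S g i) → ev f ≈ ev g
      ev-cong []      []      f≈g = refl
      ev-cong (c ∷ f) (d ∷ g) f≈g = +-cong (⟦⟧-cong (f≈g 0)) (*-congˡ (ev-cong f g λ i → f≈g (suc i)))
      ev-cong (c ∷ f) []      f≈g = ev-zero (c ∷ f) f≈g
      ev-cong []      (d ∷ g) f≈g = begin
        0#             ≈⟨ trans (+-identityˡ _) (zeroʳ x) ⟨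
        0# + x * 0#    ≈⟨ +-cong (trans (sym 0#-homo) (⟦⟧-cong (f≈g 0))) (*-congˡ (ev-cong [] g λ i → f≈g (suc i))) ⟩
        h d + x * ev g ∎

      ev-+ : ∀ f g → ev (addPoly S f g) ≈ ev f + ev g
      ev-+ []      g       = sym (+-identityˡ _)
      ev-+ (c ∷ f) []      = sym (+-identityʳ _)
      ev-+ (c ∷ f) (d ∷ g) = begin
        h (c S.+ d) + x * ev (addPoly S f g)   ≈⟨ +-cong (+-homo c d) (trans (*-congˡ (ev-+ f g)) (distribˡ _ _ _)) ⟩
        h c + h d + (x * ev f + x * ev g)      ≈⟨ interchange _ _ _ _ ⟩
        h c + x * ev f + (h d + x * ev g)      ∎

      ev-scale : ∀ c f → ev (map (c S.*_) f) ≈ h c * ev f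
      ev-scale c []      = sym (zeroʳ _)
      ev-scale c (d ∷ f) = begin
        h (c S.* d) + x * ev (map (c S.*_) f) ≈⟨ +-cong (*-homo c d) (*-congˡ (ev-scale c f)) ⟩
        h c * h d + x * (h c * ev f)          ≈⟨ +-congˡ (x∙yz≈y∙xz _ _ _) ⟩
        h c * h d + h c * (x * ev f)          ≈⟨ distribˡ _ _ _ ⟨
        h c * (h d + x * ev f)                ∎

      ev-* : ∀ f g → ev (mulPoly S f g) ≈ ev f * ev g
      ev-* []      g = sym (zeroˡ _)
      ev-* (c ∷ f) g = begin
        ev (addPoly S (map (c S.*_) g) (S.0# ∷ mulPoly S f g)) ≈⟨ ev-+ (map (c S.*_) g) _ ⟩
        ev (map (c S.*_) g) + (h S.0# + x * ev (mulPoly S f g)) ≈⟨ +-cong (ev-scale c g) (trans (+-congʳ 0#-homo) (+-identityˡ _)) ⟩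
        h c * ev g + x * ev (mulPoly S f g)  ≈⟨ +-congˡ (trans (*-congˡ (ev-* f g)) (sym (*-assoc _ _ _))) ⟩
        h c * ev g + x * ev f * ev g         ≈⟨ distribʳ _ _ _ ⟨
        (h c + x * ev f) * ev g              ∎

      ev-neg : ∀ f → ev (map S.-_ f) ≈ - ev f
      ev-neg []      = sym -0#≈0#
      ev-neg (c ∷ f) = begin
        h (S.- c) + x * ev (map S.-_ f) ≈⟨ +-cong (-‿homo c) (*-congˡ (ev-neg f)) ⟩
        - h c + x * - ev f              ≈⟨ +-congˡ (-‿distribʳ-* x _) ⟨
        - h c + - (x * ev f)            ≈⟨ -‿+-comm _ _ ⟩
        - (h c + x * ev f)              ∎

    -- As S is only a raw ring and `h` is arbitrary, the statement applies to its own conclusion: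
    -- used twice it evaluates polynomials in α and β.
    eval-isRingHom : IsRingHom (S [X]) R (λ f → eval rawRing h f x)
    eval-isRingHom = mkRingHom {S = S [X]} {R = R} (λ {f} {g} → ev-cong f g) ev-+ refl ev-*
      (trans (+-cong 1#-homo (zeroʳ x)) (+-identityʳ 1#)) ev-neg

module _ {b ℓ} (R : CommutativeRing b ℓ) where
  open CommutativeRing R
  open RingProperties ring using (-‿distribʳ-*; -‿distribˡ-*; -‿+-comm; -0#≈0#; -‿involutive)
  open SemiringMult semiring using (×1-homo-*; ×-homo-+) renaming (_×_ to _·_)
  open CommutativeSemigroupProperties +-commutativeSemigroup using (interchange)
  open SetoidReasoning setoid

  id-isRingHom : IsRingHom rawRing R (λ x → x)
  id-isRingHom = mkRingHom {S = rawRing} {R = R} (λ x≈y → x≈y) (λ _ _ → refl) refl (λ _ _ → refl) refl (λ _ → refl)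

  private
    ι : ℤ → Carrier
    ι = fromℤ rawRing

    ι-⊖ : ∀ m n → ι (m ℤ.⊖ n) ≈ m · 1# - n · 1#
    ι-⊖ m       zero    = sym (trans (+-congˡ -0#≈0#) (+-identityʳ _))
    ι-⊖ zero    (suc n) = sym (+-identityˡ _)
    ι-⊖ (suc m) (suc n) = begin
      ι (suc m ℤ.⊖ suc n)              ≡⟨ ≡.cong ι (ℤₚ.[1+m]⊖[1+n]≡m⊖n m n) ⟩
      ι (m ℤ.⊖ n)                      ≈⟨ ι-⊖ m n ⟩
      m · 1# - n · 1#                  ≈⟨ +-identityˡ _ ⟨
      0# + (m · 1# - n · 1#)           ≈⟨ +-congʳ (-‿inverseʳ 1#) ⟨
      1# - 1# + (m · 1# - n · 1#)      ≈⟨ interchange _ _ _ _ ⟩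
      1# + m · 1# + (- 1# - n · 1#)    ≈⟨ +-congˡ (-‿+-comm _ _) ⟩
      suc m · 1# - suc n · 1#          ∎

    ι-neg : ∀ z → ι (ℤ.- z) ≈ - ι z
    ι-neg (+ zero)  = sym -0#≈0#
    ι-neg (+ suc n) = refl
    ι-neg -[1+ n ]  = sym (-‿involutive _)

    ι-+ : ∀ x y → ι (x ℤ.+ y) ≈ ι x + ι y
    ι-+ (+ m)    (+ n)    = ×-homo-+ 1# m n
    ι-+ (+ m)    -[1+ n ] = ι-⊖ m (suc n)
    ι-+ -[1+ m ] (+ n)    = trans (ι-⊖ n (suc m)) (+-comm _ _)
    ι-+ -[1+ m ] -[1+ n ] = begin
      - (suc (suc (m ℕ.+ n)) · 1#)   ≡⟨ ≡.cong (λ k → - (suc k · 1#)) (ℕₚ.+-suc m n) ⟨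
      - ((suc m ℕ.+ suc n) · 1#)     ≈⟨ -‿cong (×-homo-+ 1# (suc m) (suc n)) ⟩
      - (suc m · 1# + suc n · 1#)    ≈⟨ -‿+-comm _ _ ⟨
      - (suc m · 1#) - suc n · 1#    ∎

    ι-*⁺ : ∀ x n → ι (x ℤ.* + n) ≈ ι x * ι (+ n)
    ι-*⁺ (+ m)    n = trans (reflexive (≡.cong ι (≡.sym (ℤₚ.pos-* m n)))) (×1-homo-* m n)
    ι-*⁺ -[1+ m ] n = begin
      ι (-[1+ m ] ℤ.* + n)        ≡⟨ ≡.cong ι (ℤₚ.neg-distribˡ-* (+ suc m) (+ n)) ⟨
      ι (ℤ.- (+ suc m ℤ.* + n))   ≈⟨ ι-neg (+ suc m ℤ.* + n) ⟩
      - ι (+ suc m ℤ.* + n)       ≈⟨ -‿cong (ι-*⁺ (+ suc m) n) ⟩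
      - (suc m · 1# * n · 1#)     ≈⟨ -‿distribˡ-* _ _ ⟩
      - (suc m · 1#) * n · 1#     ∎

    ι-* : ∀ x y → ι (x ℤ.* y) ≈ ι x * ι y
    ι-* x (+ n)    = ι-*⁺ x n
    ι-* x -[1+ n ] = begin
      ι (x ℤ.* -[1+ n ])       ≡⟨ ≡.cong ι (ℤₚ.neg-distribʳ-* x (+ suc n)) ⟨
      ι (ℤ.- (x ℤ.* + suc n))  ≈⟨ ι-neg (x ℤ.* + suc n) ⟩
      - ι (x ℤ.* + suc n)      ≈⟨ -‿cong (ι-*⁺ x (suc n)) ⟩
      - (ι x * ι (+ suc n))    ≈⟨ -‿distribʳ-* _ _ ⟩
      ι x * - ι (+ suc n)      ∎

  fromℤ-isRingHom : IsRingHom ℤ.+-*-rawRing R (fromℤ rawRing)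
  fromℤ-isRingHom = mkRingHom {S = ℤ.+-*-rawRing} {R = R} (λ { ≡.refl → refl }) ι-+ refl ι-* (+-identityʳ 1#) ι-neg

-- Counting reduced fractions with denominator dividing n

[1⋯_] : ℕ → List ℕ
[1⋯ n ] = map suc (upTo n)

-- Agrees by definition with the list in `Cyclotomic`, but without the ring parameter.
totatives : ℕ → List ℕ
totatives n = filter (λ j → gcd j n ℕₚ.≟ 1) [1⋯ n ]

-- The bound M is separate from n so that the divisors of n and of a multiple of n can be filtered
-- from the same interval and compared term by term.
divisorsUpTo : ℕ → ℕ → List ℕ
divisorsUpTo M n = filter (ℕ∣._∣? n) [1⋯ M ]

∈[1⋯]⁺ : ∀ {i n} → 1 ≤ i → i ≤ n → i ∈ [1⋯ n ]
∈[1⋯]⁺ {suc i} _ i<n = ∈-map⁺ suc (∈-upTo⁺ i<n)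

∈[1⋯]⁻ : ∀ {i n} → i ∈ [1⋯ n ] → 1 ≤ i × i ≤ n
∈[1⋯]⁻ i∈ with j , j∈ , ≡.refl ← ∈-map⁻ suc i∈ = s≤s z≤n , ∈-upTo⁻ j∈

[1⋯]-unique : ∀ n → Unique [1⋯ n ]
[1⋯]-unique n = Uniqueₚ.map⁺ ℕₚ.suc-injective (Uniqueₚ.upTo⁺ n)

-- (d , j) stands for the reduced fraction j / d in (0 , 1].
record ReducedFraction (n : ℕ) (x : ℕ × ℕ) : Set where
  constructor reduced
  field
    divides-n : proj₁ x ℕ∣.∣ n
    positive  : 1 ≤ proj₂ x
    bounded   : proj₂ x ≤ proj₁ x
    coprime   : gcd (proj₂ x) (proj₁ x) ≡ 1

fractions : ℕ → ℕ → List (ℕ × ℕ)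
fractions M n = concatMap (λ d → map (d ,_) (totatives d)) (divisorsUpTo M n)

∈-fractions⁻ : ∀ M n {x} → x ∈ fractions M n → ReducedFraction n x
∈-fractions⁻ M n x∈
  with d , d∈ , x∈d ← find (∈-concatMap⁻ (λ d → map (d ,_) (totatives d)) {divisorsUpTo M n} x∈)
  with j , j∈ , ≡.refl ← ∈-map⁻ (d ,_) x∈d
  with j∈[1⋯d] , gcd≡1 ← ∈-filter⁻ (λ j → gcd j d ℕₚ.≟ 1) {xs = [1⋯ d ]} j∈
  = reduced (proj₂ (∈-filter⁻ (ℕ∣._∣? n) {xs = [1⋯ M ]} d∈))
      (proj₁ (∈[1⋯]⁻ j∈[1⋯d])) (proj₂ (∈[1⋯]⁻ j∈[1⋯d])) gcd≡1

∈-fractions⁺ : ∀ {M n x} → 1 ≤ n → n ≤ M → ReducedFraction n x → x ∈ fractions M n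
∈-fractions⁺ {M} {n} {d , j} 1≤n n≤M (reduced d∣n 1≤j j≤d gcd≡1) =
  ∈-concatMap⁺ (λ d → map (d ,_) (totatives d)) (lose
    (∈-filter⁺ (ℕ∣._∣? n) (∈[1⋯]⁺ (ℕₚ.≤-trans 1≤j j≤d) (ℕₚ.≤-trans (ℕ∣.∣⇒≤ {{>-nonZero 1≤n}} d∣n) n≤M)) d∣n)
    (∈-map⁺ (d ,_) (∈-filter⁺ (λ j → gcd j d ℕₚ.≟ 1) (∈[1⋯]⁺ 1≤j j≤d) gcd≡1)))

fractions-unique : ∀ M n → Unique (fractions M n)
fractions-unique M n = Uniqueₚ.concat⁺
  (Allₚ.map⁺ (All.universal (λ d → Uniqueₚ.map⁺ (≡.cong proj₂) (Uniqueₚ.filter⁺ (λ j → gcd j d ℕₚ.≟ 1) ([1⋯]-unique d))) _))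
  (AllPairsₚ.map⁺ (AllPairs.map disjoint (Uniqueₚ.filter⁺ (ℕ∣._∣? n) ([1⋯]-unique M))))
  where
  disjoint : ∀ {d e} → d ≢ e → Disjoint (map (d ,_) (totatives d)) (map (e ,_) (totatives e))
  disjoint {d} {e} d≢e (x∈d , x∈e)
    with _ , _ , ≡.refl ← ∈-map⁻ (d ,_) x∈d
    with _ , _ , ≡.refl ← ∈-map⁻ (e ,_) x∈e = d≢e ≡.refl

module _ (n : ℕ) (1≤n : 1 ≤ n) where
  private
    g : ℕ → ℕ
    g i = gcd (suc i) n

    instance
      g≢0 : ∀ {i} → NonZero (g i)
      g≢0 {i} = ≢-nonZero (gcd[m,n]≢0 (suc i) n (inj₁ λ ()))

    reduce : ℕ → ℕ × ℕ
    reduce i = n / g i , suc i / g i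

    denominator : ∀ i → n / g i ℕ.* g i ≡ n
    denominator i = m/n*n≡m (gcd[m,n]∣n (suc i) n)

    numerator : ∀ i → suc i / g i ℕ.* g i ≡ suc i
    numerator i = m/n*n≡m (gcd[m,n]∣m (suc i) n)

    -- The two fractions have the same value (suc i) / n.
    reduce-unique : ∀ i d j c → d ℕ.* c ≡ n → j ℕ.* c ≡ suc i → gcd j d ≡ 1 → reduce i ≡ (d , j)
    reduce-unique i d j c dc≡n jc≡1+i gcd≡1 = ≡.cong₂ _,_
      (cancel (n / g i) d (≡.trans (denominator i) (≡.sym dc≡n)))
      (cancel _ _ (≡.trans (numerator i) (≡.sym jc≡1+i)))
      where
      open ≡.≡-Reasoning
      c≡g : c ≡ g i
      c≡g = begin
        c                   ≡⟨ ℕₚ.*-identityʳ c ⟨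
        c ℕ.* 1               ≡⟨ ≡.cong (c ℕ.*_) gcd≡1 ⟨
        c ℕ.* gcd j d         ≡⟨ c*gcd[m,n]≡gcd[cm,cn] c j d ⟩
        gcd (c ℕ.* j) (c ℕ.* d) ≡⟨ ≡.cong₂ gcd (≡.trans (ℕₚ.*-comm c j) jc≡1+i) (≡.trans (ℕₚ.*-comm c d) dc≡n) ⟩
        g i                 ∎
      cancel : ∀ a b → a ℕ.* g i ≡ b ℕ.* c → a ≡ b
      cancel a b eq = ℕₚ.*-cancelʳ-≡ a b (g i) (≡.trans eq (≡.cong (b ℕ.*_) c≡g))

    reduce-coprime : ∀ i → gcd (suc i / g i) (n / g i) ≡ 1
    reduce-coprime i = ℕₚ.*-cancelˡ-≡ _ 1 (g i) (begin
      g i ℕ.* gcd (suc i / g i) (n / g i)         ≡⟨ c*gcd[m,n]≡gcd[cm,cn] (g i) _ _ ⟩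
      gcd (g i ℕ.* (suc i / g i)) (g i ℕ.* (n / g i)) ≡⟨ ≡.cong₂ gcd
        (≡.trans (ℕₚ.*-comm (g i) _) (numerator i))
        (≡.trans (ℕₚ.*-comm (g i) _) (denominator i)) ⟩
      g i                                       ≡⟨ ℕₚ.*-identityʳ (g i) ⟨
      g i ℕ.* 1                                   ∎)
      where open ≡.≡-Reasoning

    -- The common denominator n / g is nonzero and determines g; the numerator times g then recovers
    -- `suc i`.
    reduce-injective : ∀ {i k} → reduce i ≡ reduce k → i ≡ k
    reduce-injective {i} {k} eq = ℕₚ.suc-injective (begin
      suc i             ≡⟨ numerator i ⟨
      suc i / g i ℕ.* g i ≡⟨ ≡.cong₂ ℕ._*_ (≡.cong proj₂ eq) g≡g ⟩
      suc k / g k ℕ.* g k ≡⟨ numerator k ⟩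
      suc k             ∎)
      where
      open ≡.≡-Reasoning
      n/g≢0 : NonZero (n / g i)
      n/g≢0 = ≢-nonZero λ n/g≡0 → ℕₚ.<⇒≢ 1≤n (≡.trans (≡.cong (ℕ._* g i) (≡.sym n/g≡0)) (denominator i))
      g≡g : g i ≡ g k
      g≡g = ℕₚ.*-cancelˡ-≡ _ _ (n / g i) {{n/g≢0}} (begin
        n / g i ℕ.* g i ≡⟨ denominator i ⟩
        n             ≡⟨ denominator k ⟨
        n / g k ℕ.* g k ≡⟨ ≡.cong (ℕ._* g k) (≡.cong proj₁ eq) ⟨
        n / g i ℕ.* g k ∎)

    reduce-isReduced : ∀ {i} → i < n → ReducedFraction n (reduce i)
    reduce-isReduced {i} i<n = reduced
      (ℕ∣.divides (g i) (≡.trans (≡.sym (denominator i)) (ℕₚ.*-comm _ (g i))))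
      (ℕₚ.n≢0⇒n>0 λ j≡0 → ℕₚ.0≢1+n (≡.trans (≡.cong (ℕ._* g i) (≡.sym j≡0)) (numerator i)))
      (ℕₚ.*-cancelʳ-≤ _ _ (g i) (≡.subst₂ _≤_ (≡.sym (numerator i)) (≡.sym (denominator i)) i<n))
      (reduce-coprime i)

    -- If n = c d, then j / d = (j c) / n, so its position in `upTo n` is the predecessor of j c.
    -- Naming j c by a variable allows it to be matched as a successor.
    fraction⇒∈ : ∀ {x} → ReducedFraction n x → x ∈ map reduce (upTo n)
    fraction⇒∈ {d , j} (reduced (ℕ∣.divides c n≡cd) 1≤j j≤d gcd≡1) =
      attempt (j ℕ.* c) ≡.refl
      where
      dc≡n : d ℕ.* c ≡ n
      dc≡n = ≡.trans (ℕₚ.*-comm d c) (≡.sym n≡cd)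
      attempt : ∀ i → j ℕ.* c ≡ i → (d , j) ∈ map reduce (upTo n)
      attempt (suc i) jc≡i = ≡.subst (_∈ map reduce (upTo n)) (reduce-unique i d j c dc≡n jc≡i gcd≡1)
        (∈-map⁺ reduce (∈-upTo⁺ (≡.subst₂ _≤_ jc≡i dc≡n (ℕₚ.*-monoˡ-≤ c j≤d))))
      attempt zero jc≡0 = ⊥-elim (ℕₚ.<⇒≢ 1≤n (≡.trans (≡.sym (≡.trans (≡.cong (d ℕ.*_) c≡0) (ℕₚ.*-zeroʳ d))) dc≡n))
        where
        c≡0 : c ≡ 0
        c≡0 = ℕₚ.m*n≡0⇒m≡0 c j {{>-nonZero 1≤j}} (≡.trans (ℕₚ.*-comm c j) jc≡0)

  -- Gauss's identity: the totients of the divisors of n sum to n. Reducing 1/n, ..., n/n to lowest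
  -- terms gives a list without repetitions that has the same members, hence the same length.
  length-fractions : ∀ M → n ≤ M → length (fractions M n) ≡ n
  length-fractions M n≤M = begin
    length (fractions M n)        ≡⟨ ↭-length (∼bag⇒↭ (unique∧set⇒bag (fractions-unique M n)
                                       (Uniqueₚ.map⁺ reduce-injective (Uniqueₚ.upTo⁺ n)) same-members)) ⟩
    length (map reduce (upTo n))  ≡⟨ Listₚ.length-map reduce (upTo n) ⟩
    length (upTo n)               ≡⟨ Listₚ.length-upTo n ⟩
    n                             ∎
    where
    open ≡.≡-Reasoning
    ∈-fractions⇐ : ∀ {x} → x ∈ map reduce (upTo n) → x ∈ fractions M n
    ∈-fractions⇐ x∈ with i , i∈ , ≡.refl ← ∈-map⁻ reduce x∈ =
      ∈-fractions⁺ 1≤n n≤M (reduce-isReduced (∈-upTo⁻ i∈))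
    same-members : fractions M n ∼[ set ] map reduce (upTo n)
    same-members = mk⇔ (λ x∈ → fraction⇒∈ (∈-fractions⁻ M n x∈)) ∈-fractions⇐

-- Products over roots of unity

module _ {b ℓ} (R : CommutativeRing b ℓ) where
  open CommutativeRing R

  ∏ : ∀ {a} {A : Set a} → (A → Carrier) → List A → Carrier
  ∏ f xs = foldr _*_ 1# (map f xs)

  module _ {a} {A : Set a} where
    ∏-cong : ∀ {f g : A → Carrier} (xs : List A) → (∀ {x} → x ∈ xs → f x ≈ g x) → ∏ f xs ≈ ∏ g xs
    ∏-cong []       f≈g = refl
    ∏-cong (x ∷ xs) f≈g = *-cong (f≈g (here ≡.refl)) (∏-cong xs (f≈g ∘ there))

    ∏-++ : ∀ (f : A → Carrier) xs ys → ∏ f (xs ++ ys) ≈ ∏ f xs * ∏ f ys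
    ∏-++ f []       ys = sym (*-identityˡ _)
    ∏-++ f (x ∷ xs) ys = trans (*-congˡ (∏-++ f xs ys)) (sym (*-assoc _ _ _))

    ∏-map : ∀ {e} {B : Set e} (f : A → Carrier) (g : B → A) xs → ∏ f (map g xs) ≈ ∏ (f ∘ g) xs
    ∏-map f g []       = refl
    ∏-map f g (x ∷ xs) = *-congˡ (∏-map f g xs)

    ∏-concatMap : ∀ {e} {B : Set e} (f : A → Carrier) (g : B → List A) xs →
                  ∏ f (concatMap g xs) ≈ ∏ (λ x → ∏ f (g x)) xs
    ∏-concatMap f g []       = refl
    ∏-concatMap f g (x ∷ xs) = trans (∏-++ f (g x) _) (*-congˡ (∏-concatMap f g xs))

module _ {a ℓ₁ b ℓ₂} {S : RawRing a ℓ₁} (R : CommutativeRing b ℓ₂)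
         {h : RawRing.Carrier S → CommutativeRing.Carrier R} (isHom : IsRingHom S R h) where
  private
    module S = RawRing S
  open CommutativeRing R
  open RingMorphisms.IsRingHomomorphism isHom

  ∏-natural : ∀ {a} {A : Set a} (f : A → S.Carrier) xs →
              h (foldr S._*_ S.1# (map f xs)) ≈ ∏ R (h ∘ f) xs
  ∏-natural f []       = 1#-homo
  ∏-natural f (x ∷ xs) = trans (*-homo _ _) (*-congˡ (∏-natural f xs))

-- Factorisation of monic polynomials over a Heyting field.

module _ {c ℓ₁ ℓ₂} (K : HeytingField c ℓ₁ ℓ₂) where
  commutativeRing : CommutativeRing c ℓ₁
  commutativeRing = HeytingCommutativeRing.commutativeRing (HeytingField.heytingCommutativeRing K)

  open CommutativeRing commutativeRing hiding (zero)
  open HeytingField K using (tight; #⇒invertible)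
  open RingProperties ring using (-0#≈0#; -1*x≈-x)
  open GroupProperties +-group using ()
    renaming (x∙y⁻¹≈ε⇒x≈y to x-y≈0⇒x≈y; x≈y⇒x∙y⁻¹≈ε to x≈y⇒x-y≈0; //-rightDividesˡ to [x-y]+y≈x)
  open SemiringExp semiring using (_^_; ^-congˡ; ^-congʳ; ^-homo-*; ^-assocʳ)
  open CommutativeSemigroupProperties *-commutativeSemigroup using (x∙yz≈y∙xz)
  open SetoidReasoning setoid

  -- Equality need not be decidable, but tightness reduces y ≈ 0 to refuting y # 0, and an element
  -- apart from 0 has an inverse.
  nonzero-cancel : ∀ {x y} → ¬ (x ≈ 0#) → x * y ≈ 0# → y ≈ 0#
  nonzero-cancel {x} {y} x≉0 xy≈0 = proj₁ (tight y 0#) λ y#0 →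
    let y⁻¹ , _ , y*y⁻¹≈1 = #⇒invertible y#0 in x≉0 (begin
      x                    ≈⟨ *-identityʳ x ⟨
      x * 1#               ≈⟨ *-congˡ y*y⁻¹≈1 ⟨
      x * ((y - 0#) * y⁻¹) ≈⟨ *-congˡ (*-congʳ (trans (+-congˡ -0#≈0#) (+-identityʳ y))) ⟩
      x * (y * y⁻¹)        ≈⟨ *-assoc _ _ _ ⟨
      x * y * y⁻¹          ≈⟨ *-congʳ xy≈0 ⟩
      0# * y⁻¹             ≈⟨ zeroˡ _ ⟩
      0#                   ∎)

  -- The list holds the lower coefficients of a monic polynomial, which is
  -- homogenised by the second variable.
  monic : List Carrier → Carrier → Carrier → Carrier
  monic []       a b = 1#
  monic (c ∷ cs) a b = c * b ^ suc (length cs) + a * monic cs a b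

  -- monic (quotient r cs) is the quotient of monic (c ∷ cs) by a - r b.
  quotient : Carrier → List Carrier → List Carrier
  quotient r []       = []
  quotient r (c ∷ cs) = monic (c ∷ cs) r 1# ∷ quotient r cs

  length-quotient : ∀ r cs → length (quotient r cs) ≡ length cs
  length-quotient r []       = ≡.refl
  length-quotient r (c ∷ cs) = ≡.cong suc (length-quotient r cs)

  1^n≈1 : ∀ n → 1# ^ n ≈ 1#
  1^n≈1 zero    = refl
  1^n≈1 (suc n) = trans (*-identityˡ _) (1^n≈1 n)

  -- The remainder theorem in homogeneous form. The induction step rewrites the factor a in front of
  -- the old remainder as (a - r b) + r b.
  monic-remainder : ∀ r c cs a b → monic (c ∷ cs) a b ≈
                    (a - r * b) * monic (quotient r cs) a b + monic (c ∷ cs) r 1# * b ^ suc (length cs)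
  monic-remainder r c [] a b = begin
    c * (b * 1#) + a * 1#                          ≈⟨ +-cong (*-congˡ (*-identityʳ b)) (*-identityʳ a) ⟩
    c * b + a                                      ≈⟨ +-comm _ _ ⟩
    a + c * b                                      ≈⟨ +-congʳ ([x-y]+y≈x (r * b) a) ⟨
    a - r * b + r * b + c * b                      ≈⟨ +-assoc _ _ _ ⟩
    a - r * b + (r * b + c * b)                    ≈⟨ +-cong (sym (*-identityʳ _)) (trans (+-comm _ _) (sym (distribʳ b c r))) ⟩
    (a - r * b) * 1# + (c + r) * b                 ≈⟨ +-congˡ (*-cong
      (+-cong (sym (trans (*-congˡ (*-identityʳ 1#)) (*-identityʳ c))) (sym (*-identityʳ r)))
      (sym (*-identityʳ b))) ⟩
    (a - r * b) * 1# + (c * (1# * 1#) + r * 1#) * (b * 1#) ∎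
  monic-remainder r c (d ∷ ds) a b = begin
    c * bb + a * F                               ≈⟨ +-congˡ (*-congˡ (monic-remainder r d ds a b)) ⟩
    c * bb + a * ((a - r * b) * Q + ρ * B)       ≈⟨ +-congˡ (distribˡ _ _ _) ⟩
    c * bb + (a * ((a - r * b) * Q) + a * (ρ * B)) ≈⟨ +-congˡ (+-cong (x∙yz≈y∙xz _ _ _) a*ρB) ⟩
    c * bb + ((a - r * b) * (a * Q) + ((a - r * b) * (ρ * B) + r * ρ * bb)) ≈⟨ +-congˡ (+-assoc _ _ _) ⟨
    c * bb + ((a - r * b) * (a * Q) + (a - r * b) * (ρ * B) + r * ρ * bb) ≈⟨ +-congˡ (+-congʳ (trans (sym (distribˡ _ _ _)) (*-congˡ (+-comm _ _)))) ⟩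
    c * bb + ((a - r * b) * (ρ * B + a * Q) + r * ρ * bb) ≈⟨ trans (sym (+-assoc _ _ _)) (trans (+-congʳ (+-comm _ _)) (+-assoc _ _ _)) ⟩
    (a - r * b) * (ρ * B + a * Q) + (c * bb + r * ρ * bb) ≈⟨ +-congˡ (distribʳ _ _ _) ⟨
    (a - r * b) * (ρ * B + a * Q) + (c + r * ρ) * bb ≈⟨ +-cong
      (*-congˡ (+-congʳ (*-congˡ (^-congʳ b (≡.cong suc (≡.sym (length-quotient r ds)))))))
      (*-congʳ (+-congʳ (sym c*1))) ⟩
    (a - r * b) * monic (ρ ∷ quotient r ds) a b + monic (c ∷ d ∷ ds) r 1# * bb ∎
    where
    F = monic (d ∷ ds) a b
    Q = monic (quotient r ds) a b
    ρ = monic (d ∷ ds) r 1#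
    B = b ^ suc (length ds)
    bb = b ^ suc (suc (length ds))
    c*1 : c * 1# ^ suc (suc (length ds)) ≈ c
    c*1 = trans (*-congˡ (1^n≈1 (suc (suc (length ds))))) (*-identityʳ c)
    a*ρB : a * (ρ * B) ≈ (a - r * b) * (ρ * B) + r * ρ * bb
    a*ρB = begin
      a * (ρ * B)                                        ≈⟨ *-congʳ ([x-y]+y≈x (r * b) a) ⟨
      (a - r * b + r * b) * (ρ * B)                      ≈⟨ distribʳ _ _ _ ⟩
      (a - r * b) * (ρ * B) + r * b * (ρ * B) ≈⟨ +-congˡ
        (trans (*-assoc _ _ _) (trans (*-congˡ (x∙yz≈y∙xz b ρ B)) (sym (*-assoc _ _ _)))) ⟩
      (a - r * b) * (ρ * B) + r * ρ * bb                 ∎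

  -- Each root splits off a linear factor. A further root differs from r, so a - r b does not vanish
  -- at it and the quotient must. The factors are exhausted when the number of roots reaches the
  -- degree.
  split-monic : ∀ cs rs → length cs ≡ length rs → AllPairs (λ x y → ¬ (x ≈ y)) rs →
                All (λ r → monic cs r 1# ≈ 0#) rs →
                ∀ a b → monic cs a b ≈ ∏ commutativeRing (λ r → a - r * b) rs
  split-monic []       []       _  _                     _              a b = refl
  split-monic (c ∷ cs) (r ∷ rs) eq (r≉rs ∷ distinct) (root ∷ roots) a b = begin
    monic (c ∷ cs) a b                                                           ≈⟨ monic-remainder r c cs a b ⟩
    (a - r * b) * monic (quotient r cs) a b + monic (c ∷ cs) r 1# * b ^ suc (length cs) ≈⟨ +-congˡ (trans (*-congʳ root) (zeroˡ _)) ⟩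
    (a - r * b) * monic (quotient r cs) a b + 0#                                 ≈⟨ +-identityʳ _ ⟩
    (a - r * b) * monic (quotient r cs) a b ≈⟨ *-congˡ (split-monic (quotient r cs) rs
      (≡.trans (length-quotient r cs) (ℕₚ.suc-injective eq)) distinct
      (All.zipWith (λ { (r≉x , x-root) → quotient-root r≉x x-root }) (r≉rs , roots)) a b) ⟩
    (a - r * b) * ∏ commutativeRing (λ r → a - r * b) rs                         ∎
    where
    quotient-root : ∀ {x} → ¬ (r ≈ x) → monic (c ∷ cs) x 1# ≈ 0# → monic (quotient r cs) x 1# ≈ 0#
    quotient-root {x} r≉x x-root = nonzero-cancel
      (λ x-r≈0 → r≉x (sym (trans (x-y≈0⇒x≈y _ _ x-r≈0) (*-identityʳ r)))) (begin
      (x - r * 1#) * monic (quotient r cs) x 1#      ≈⟨ +-identityʳ _ ⟨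
      (x - r * 1#) * monic (quotient r cs) x 1# + 0# ≈⟨ +-congˡ (trans (*-congʳ root) (zeroˡ _)) ⟨
      (x - r * 1#) * monic (quotient r cs) x 1# + monic (c ∷ cs) r 1# * 1# ^ suc (length cs) ≈⟨ monic-remainder r c cs x 1# ⟨
      monic (c ∷ cs) x 1#                            ≈⟨ x-root ⟩
      0#                                             ∎)

  monic-power : ∀ n a b → monic (replicate n 0#) a b ≈ a ^ n
  monic-power zero    a b = refl
  monic-power (suc n) a b = trans (+-cong (zeroˡ _) (*-congˡ (monic-power n a b))) (+-identityˡ _)

  -- The coefficients -1, 0, ..., 0 below the leading one are those of X^(n+1) - 1, whose
  -- homogenisation is the right-hand side.
  split-difference-of-powers : ∀ n rs → length rs ≡ suc n → AllPairs (λ x y → ¬ (x ≈ y)) rs →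
    All (λ r → r ^ suc n ≈ 1#) rs →
    ∀ a b → ∏ commutativeRing (λ r → a - r * b) rs ≈ a ^ suc n - b ^ suc n
  split-difference-of-powers n rs len distinct roots a b = trans
    (sym (split-monic (- 1# ∷ replicate n 0#) rs (≡.trans (≡.cong suc (Listₚ.length-replicate n)) (≡.sym len)) distinct
      (All.map (λ {r} r^n≈1 → trans (monic-difference r 1#) (x≈y⇒x-y≈0 (trans r^n≈1 (sym (1^n≈1 (suc n)))))) roots) a b))
    (monic-difference a b)
    where
    monic-difference : ∀ a b → monic (- 1# ∷ replicate n 0#) a b ≈ a ^ suc n - b ^ suc n
    monic-difference a b = begin
      - 1# * b ^ suc (length (replicate n 0#)) + a * monic (replicate n 0#) a b ≈⟨ +-cong
        (trans (*-congˡ (^-congʳ b (≡.cong suc (Listₚ.length-replicate n)))) (-1*x≈-x _))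
        (*-congˡ (monic-power n a b)) ⟩
      - (b ^ suc n) + a ^ suc n ≈⟨ +-comm _ _ ⟩
      a ^ suc n - b ^ suc n     ∎

  primitive-order : ∀ {n z} .{{_ : NonZero n}} → IsPrimitiveRoot K n z → ∀ k → z ^ k ≈ 1# → n ℕ∣.∣ k
  primitive-order {n} {z} (z^n≈1 , minimal) k z^k≈1 with k % n in eq
  ... | zero = ℕ∣.m%n≡0⇒n∣m k n eq
  ... | suc r = contradiction z^r≈1 (minimal (suc r) (s≤s z≤n) (≡.subst (_< n) eq (m%n<n k n)))
    where
    z^r≈1 : z ^ suc r ≈ 1#
    z^r≈1 = begin
      z ^ suc r                     ≈⟨ *-identityʳ _ ⟨
      z ^ suc r * 1#                ≈⟨ *-congˡ (trans (sym (1^n≈1 (k / n))) (^-congˡ (k / n) (sym z^n≈1))) ⟩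
      z ^ suc r * (z ^ n) ^ (k / n) ≈⟨ *-congˡ (trans (^-assocʳ z n (k / n)) (^-congʳ z (ℕₚ.*-comm n (k / n)))) ⟩
      z ^ suc r * z ^ (k / n ℕ.* n) ≈⟨ ^-homo-* z (suc r) _ ⟨
      z ^ (suc r ℕ.+ k / n ℕ.* n)   ≡⟨ ≡.cong (λ e → z ^ (e ℕ.+ k / n ℕ.* n)) eq ⟨
      z ^ (k % n ℕ.+ k / n ℕ.* n)   ≡⟨ ≡.cong (z ^_) (m≡m%n+[m/n]*n k n) ⟨
      z ^ k                         ≈⟨ z^k≈1 ⟩
      1#                            ∎

  -- Roots of unity indexed by reduced fractions.

  module _ (ω : ℕ → Carrier) (ω-primitive : ∀ n → 1 ≤ n → IsPrimitiveRoot K n (ω n)) where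
    root : ℕ × ℕ → Carrier
    root (d , j) = ω d ^ j

    root-power : ∀ d j k → root (d , j) ^ k ≈ ω d ^ (j ℕ.* k)
    root-power d j k = ^-assocʳ (ω d) j k

    fraction-positive : ∀ {n x} → ReducedFraction n x → 1 ≤ proj₁ x
    fraction-positive (reduced _ 1≤j j≤d _) = ℕₚ.≤-trans 1≤j j≤d

    root^d≈1 : ∀ {n x} → ReducedFraction n x → root x ^ proj₁ x ≈ 1#
    root^d≈1 {n} {d , j} x-red = begin
      root (d , j) ^ d ≈⟨ trans (root-power d j d) (^-congʳ (ω d) (ℕₚ.*-comm j d)) ⟩
      ω d ^ (d ℕ.* j)  ≈⟨ ^-assocʳ (ω d) d j ⟨
      (ω d ^ d) ^ j    ≈⟨ ^-congˡ j (proj₁ (ω-primitive d (fraction-positive x-red))) ⟩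
      1# ^ j           ≈⟨ 1^n≈1 j ⟩
      1#               ∎

    root^n≈1 : ∀ {n x} → ReducedFraction n x → root x ^ n ≈ 1#
    root^n≈1 {n} {d , j} x-red@(reduced (ℕ∣.divides c n≡cd) _ _ _) = begin
      root (d , j) ^ n         ≡⟨ ≡.cong (root (d , j) ^_) (≡.trans n≡cd (ℕₚ.*-comm c d)) ⟩
      root (d , j) ^ (d ℕ.* c) ≈⟨ ^-assocʳ _ d c ⟨
      (root (d , j) ^ d) ^ c   ≈⟨ ^-congˡ c (root^d≈1 x-red) ⟩
      1# ^ c                   ≈⟨ 1^n≈1 c ⟩
      1#                       ∎

    -- The order d of `ω d` divides j k, and j is prime to d.
    root-order : ∀ {n x} → ReducedFraction n x → ∀ k → root x ^ k ≈ 1# → proj₁ x ℕ∣.∣ k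
    root-order {n} {d , j} x-red k z^k≈1 =
      coprime-divisor {d} {j} (Coprimality.sym (gcd≡1⇒coprime (ReducedFraction.coprime x-red)))
        (primitive-order {{>-nonZero (fraction-positive x-red)}} (ω-primitive d (fraction-positive x-red)) (j ℕ.* k)
          (trans (sym (root-power d j k)) z^k≈1))

    -- Multiplication by ω^(d-j), the inverse of ω^j, yields ω^(k-j) ≈ 1; since j ≥ 1, the exponent
    -- k - j is less than d and must be 0.
    powers-distinct : ∀ {d j k} → 1 ≤ j → j ≤ k → k ≤ d → ω d ^ j ≈ ω d ^ k → j ≡ k
    powers-distinct {d} {j} {k} 1≤j j≤k k≤d ωʲ≈ωᵏ with k ℕ.∸ j in eq
    ... | zero  = ℕₚ.≤-antisym j≤k (ℕₚ.m∸n≡0⇒m≤n eq)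
    ... | suc r = contradiction (primitive-order {{>-nonZero 1≤d}} (ω-primitive d 1≤d) (suc r) ω^r≈1)
                    (ℕ∣.>⇒∤ (≡.subst (_< d) eq (ℕₚ.<-≤-trans (ℕₚ.∸-monoʳ-< 1≤j j≤k) k≤d)))
      where
      1≤d : 1 ≤ d
      1≤d = ℕₚ.≤-trans 1≤j (ℕₚ.≤-trans j≤k k≤d)
      exponents : suc r ℕ.+ d ≡ k ℕ.+ (d ℕ.∸ j)
      exponents = ≡.trans (≡.cong (ℕ._+ d) (≡.sym eq))
        (≡.trans (≡.sym (ℕₚ.+-∸-comm d j≤k)) (ℕₚ.+-∸-assoc k (ℕₚ.≤-trans j≤k k≤d)))
      ω^r≈1 : ω d ^ suc r ≈ 1#
      ω^r≈1 = begin
        ω d ^ suc r                    ≈⟨ *-identityʳ _ ⟨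
        ω d ^ suc r * 1#               ≈⟨ *-congˡ (proj₁ (ω-primitive d 1≤d)) ⟨
        ω d ^ suc r * ω d ^ d          ≈⟨ ^-homo-* (ω d) (suc r) d ⟨
        ω d ^ (suc r ℕ.+ d)            ≡⟨ ≡.cong (ω d ^_) exponents ⟩
        ω d ^ (k ℕ.+ (d ℕ.∸ j))        ≈⟨ ^-homo-* (ω d) k (d ℕ.∸ j) ⟩
        ω d ^ k * ω d ^ (d ℕ.∸ j)      ≈⟨ *-congʳ ωʲ≈ωᵏ ⟨
        ω d ^ j * ω d ^ (d ℕ.∸ j)      ≈⟨ ^-homo-* (ω d) j (d ℕ.∸ j) ⟨
        ω d ^ (j ℕ.+ (d ℕ.∸ j))        ≡⟨ ≡.cong (ω d ^_) (ℕₚ.m+[n∸m]≡n (ℕₚ.≤-trans j≤k k≤d)) ⟩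
        ω d ^ d                        ≈⟨ proj₁ (ω-primitive d 1≤d) ⟩
        1#                             ∎

    -- Equal roots have equal orders, and the order of the root of j / d is d; so the denominators
    -- agree, and only powers of a single `ω d` remain to be compared.
    root-injective : ∀ {n x y} → ReducedFraction n x → ReducedFraction n y → root x ≈ root y → x ≡ y
    root-injective {n} {d , j} {e , k} x-red y-red x≈y
      with ≡.refl ← ℕ∣.∣-antisym
             (root-order x-red e (trans (^-congˡ e x≈y) (root^d≈1 y-red)))
             (root-order y-red d (trans (^-congˡ d (sym x≈y)) (root^d≈1 x-red)))
      with ℕₚ.≤-total j k
    ... | inj₁ j≤k = ≡.cong (d ,_) (powers-distinct (ReducedFraction.positive x-red) j≤k (ReducedFraction.bounded y-red) x≈y)
    ... | inj₂ k≤j = ≡.cong (d ,_) (≡.sym (powers-distinct (ReducedFraction.positive y-red) k≤j (ReducedFraction.bounded x-red) (sym x≈y)))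

    roots-distinct : ∀ {n xs} → All (ReducedFraction n) xs → Unique xs →
                     AllPairs (λ x y → ¬ (x ≈ y)) (map root xs)
    roots-distinct []             []            = []
    roots-distinct (x-red ∷ reds) (x≢xs ∷ uniq) =
      Allₚ.map⁺ (All.zipWith (λ { (x≢y , y-red) x≈y → x≢y (root-injective x-red y-red x≈y) }) (x≢xs , reds))
      ∷ roots-distinct reds uniq

    -- Flattened, the double product runs over the n reduced fractions whose denominators divide n,
    -- that is, over n distinct n-th roots of unity. The `ω d` are chosen independently of each
    -- other; roots for different d are told apart by their orders.
    ∏-cyclotomic : ∀ n M → 1 ≤ n → n ≤ M → ∀ a b →
      ∏ commutativeRing (λ d → ∏ commutativeRing (λ j → a - ω d ^ j * b) (totatives d)) (divisorsUpTo M n)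
      ≈ a ^ n - b ^ n
    ∏-cyclotomic n@(suc m) M 1≤n n≤M a b = begin
      ∏ commutativeRing (λ d → ∏ commutativeRing (λ j → factor (d , j)) (totatives d)) (divisorsUpTo M n)
        ≈⟨ ∏-cong commutativeRing (divisorsUpTo M n) (λ {d} _ → ∏-map commutativeRing factor (d ,_) (totatives d)) ⟨
      ∏ commutativeRing (λ d → ∏ commutativeRing factor (map (d ,_) (totatives d))) (divisorsUpTo M n)
        ≈⟨ ∏-concatMap commutativeRing factor (λ d → map (d ,_) (totatives d)) (divisorsUpTo M n) ⟨
      ∏ commutativeRing factor (fractions M n)
        ≈⟨ ∏-map commutativeRing (λ r → a - r * b) root (fractions M n) ⟨
      ∏ commutativeRing (λ r → a - r * b) (map root (fractions M n))
        ≈⟨ split-difference-of-powers m _ (≡.trans (Listₚ.length-map root (fractions M n)) (length-fractions n 1≤n M n≤M))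
             (roots-distinct all-reduced (fractions-unique M n)) (Allₚ.map⁺ (All.map root^n≈1 all-reduced)) a b ⟩
      a ^ n - b ^ n ∎
      where
      factor : ℕ × ℕ → Carrier
      factor x = a - root x * b
      all-reduced : All (ReducedFraction n) (fractions M n)
      all-reduced = All.tabulate (∈-fractions⁻ M n)

    -- Values of the atoms at integer arguments.

    module _ (char0 : CharacteristicZero K) (P : ℕ → RawRing.Carrier ℤ[s,t]) (atoms : IsLucasAtoms K ω P) (A B : ℤ) where
      private
        ι : ℤ → Carrier
        ι = fromℤ rawRing
        ι-isRingHom : IsRingHom ℤ.+-*-rawRing commutativeRing ι
        ι-isRingHom = fromℤ-isRingHom commutativeRing
        module ι = RingMorphisms.IsRingHomomorphism ι-isRingHom
        module Cyc = Cyclotomic rawRing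
        a b : Carrier
        a = ι A
        b = ι B

        ev : RawRing.Carrier Cyc.R[α,β] → Carrier
        ev f = eval rawRing (λ g → eval rawRing (λ x → x) g a) f b
        ev-isRingHom : IsRingHom Cyc.R[α,β] commutativeRing ev
        ev-isRingHom = eval-isRingHom commutativeRing (eval-isRingHom commutativeRing (id-isRingHom commutativeRing) a) b
        module ev = RingMorphisms.IsRingHomomorphism ev-isRingHom

        constant : ∀ r x → r + x * 0# ≈ r
        constant r x = trans (+-congˡ (zeroʳ x)) (+-identityʳ r)

        ev-α : ev Cyc.α ≈ a
        ev-α = trans (constant _ b) (trans (+-identityˡ _) (trans (*-congˡ (constant _ a)) (*-identityʳ a)))

        ev-β : ev Cyc.β ≈ b
        ev-β = trans (+-identityˡ _) (trans (*-congˡ (trans (constant _ b) (constant _ a))) (*-identityʳ b))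

        ev-scalar : ∀ x → ev (Cyc.scalar x) ≈ x
        ev-scalar x = trans (constant _ b) (constant x a)

        ι-neg : ∀ x → ι (ℤ.- x) ≈ - ι x
        ι-neg = ι.-‿homo

        -- Characteristic zero makes ℤ a subring of K, so that an identity between integers can be
        -- verified in K.
        ι-injective : ∀ {x y} → ι x ≈ ι y → x ≡ y
        ι-injective {x} {y} ιx≈ιy = ℤₚ.i-j≡0⇒i≡j x y (kernel (x ℤ.- y) (begin
          ι (x ℤ.- y) ≈⟨ trans (ι.+-homo x (ℤ.- y)) (+-congˡ (ι-neg y)) ⟩
          ι x - ι y   ≈⟨ x≈y⇒x-y≈0 ιx≈ιy ⟩
          0#          ∎))
          where
          kernel : ∀ z → ι z ≈ 0# → z ≡ 0ℤ
          kernel (+ zero)  _    = ≡.refl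
          kernel (+ suc n) ιz≈0 = contradiction ιz≈0 (char0 (suc n) (s≤s z≤n))
          kernel -[1+ n ]  ιz≈0 = contradiction (trans (ι-neg -[1+ n ]) (trans (-‿cong ιz≈0) -0#≈0#)) (char0 (suc n) (s≤s z≤n))

        ι-^ : ∀ x n → ι (x ℤ.^ n) ≈ ι x ^ n
        ι-^ x zero    = ι.1#-homo
        ι-^ x (suc n) = trans (ι.*-homo x _) (*-congˡ (ι-^ x n))

      -- The first Lucas atom is normalised to 1 whereas Φ₁ = α - β.
      cyclotomicValue : ℕ → ℤ
      cyclotomicValue 1 = A ℤ.- B
      cyclotomicValue n = evalℤ[s,t] (P n) (A ℤ.+ B) (ℤ.- (A ℤ.* B))

      private
        -- The defining identity of the atom is specialised at α = a, β = b. Here `ev` sends α + β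
        -- and -αβ to the images of A + B and -AB, and it respects the integer coefficients by
        -- `fromℤ-natural`.
        ι-atom : ∀ d → 2 ≤ d → ι (evalℤ[s,t] (P d) (A ℤ.+ B) (ℤ.- (A ℤ.* B))) ≈
                 ∏ commutativeRing (λ j → a - ω d ^ j * b) (totatives d)
        ι-atom d 2≤d = begin
          ι (evalℤ[s,t] (P d) (A ℤ.+ B) (ℤ.- (A ℤ.* B)))
            ≈⟨ eval₂-natural commutativeRing ι-isRingHom (λ z → z) (P d) (A ℤ.+ B) (ℤ.- (A ℤ.* B)) ⟩
          eval₂ rawRing ι (P d) (ι (A ℤ.+ B)) (ι (ℤ.- (A ℤ.* B)))
            ≈⟨ eval-cong commutativeRing (λ g → eval-cong commutativeRing
                 (λ z → sym (fromℤ-natural commutativeRing ev-isRingHom z)) g sum≈) (P d) product≈ ⟩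
          eval₂ rawRing (λ z → ev (fromℤ Cyc.R[α,β] z)) (P d) (ev (Cyc.α Cyc.+ Cyc.β)) (ev (Cyc.- (Cyc.α Cyc.* Cyc.β)))
            ≈⟨ eval₂-natural commutativeRing ev-isRingHom (fromℤ Cyc.R[α,β]) (P d) (Cyc.α Cyc.+ Cyc.β) (Cyc.- (Cyc.α Cyc.* Cyc.β)) ⟨
          ev (eval₂ Cyc.R[α,β] (fromℤ Cyc.R[α,β]) (P d) (Cyc.α Cyc.+ Cyc.β) (Cyc.- (Cyc.α Cyc.* Cyc.β)))
            ≈⟨ ev.⟦⟧-cong
                 {eval₂ Cyc.R[α,β] (fromℤ Cyc.R[α,β]) (P d) (Cyc.α Cyc.+ Cyc.β) (Cyc.- (Cyc.α Cyc.* Cyc.β))}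
                 {Cyc.Φ d (ω d)} (proj₂ atoms d 2≤d) ⟩
          ev (Cyc.Φ d (ω d))
            ≈⟨ ∏-natural commutativeRing ev-isRingHom (λ j → Cyc.α Cyc.+ (Cyc.- (Cyc.scalar (ω d ^ j) Cyc.* Cyc.β))) (totatives d) ⟩
          ∏ commutativeRing (λ j → ev (Cyc.α Cyc.+ (Cyc.- (Cyc.scalar (ω d ^ j) Cyc.* Cyc.β)))) (totatives d)
            ≈⟨ ∏-cong commutativeRing (totatives d) (λ {j} _ → linear-factor j) ⟩
          ∏ commutativeRing (λ j → a - ω d ^ j * b) (totatives d) ∎
          where
          sum≈ : ι (A ℤ.+ B) ≈ ev (Cyc.α Cyc.+ Cyc.β)
          sum≈ = trans (ι.+-homo A B) (sym (trans (ev.+-homo Cyc.α Cyc.β) (+-cong ev-α ev-β)))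
          product≈ : ι (ℤ.- (A ℤ.* B)) ≈ ev (Cyc.- (Cyc.α Cyc.* Cyc.β))
          product≈ = trans (ι-neg (A ℤ.* B)) (trans
                       (-‿cong (trans (ι.*-homo A B) (sym (trans (ev.*-homo Cyc.α Cyc.β) (*-cong ev-α ev-β)))))
                       (sym (ev.-‿homo (Cyc.α Cyc.* Cyc.β))))
          linear-factor : ∀ j → ev (Cyc.α Cyc.+ (Cyc.- (Cyc.scalar (ω d ^ j) Cyc.* Cyc.β))) ≈ a - ω d ^ j * b
          linear-factor j = trans (ev.+-homo Cyc.α (Cyc.- (Cyc.scalar (ω d ^ j) Cyc.* Cyc.β))) (+-cong ev-α (trans
            (ev.-‿homo (Cyc.scalar (ω d ^ j) Cyc.* Cyc.β))
            (-‿cong (trans (ev.*-homo (Cyc.scalar (ω d ^ j)) Cyc.β) (*-cong (ev-scalar _) ev-β)))))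

        ι-cyclotomicValue : ∀ d → 1 ≤ d → ι (cyclotomicValue d) ≈ ∏ commutativeRing (λ j → a - ω d ^ j * b) (totatives d)
        ι-cyclotomicValue 1 _ = begin
          ι (A ℤ.- B)                 ≈⟨ trans (ι.+-homo A (ℤ.- B)) (+-congˡ (ι-neg B)) ⟩
          -- The only totative of 1 is 1 itself, and a primitive first root of unity is 1.
          a - b                       ≈⟨ +-congˡ (-‿cong (trans (*-congʳ (proj₁ (ω-primitive 1 (s≤s z≤n)))) (*-identityˡ b))) ⟨
          a - ω 1 ^ 1 * b             ≈⟨ *-identityʳ _ ⟨
          (a - ω 1 ^ 1 * b) * 1#      ∎
        ι-cyclotomicValue (suc (suc d)) _ = ι-atom (suc (suc d)) (s≤s (s≤s z≤n))

      ∏-cyclotomicValue : ∀ n M → 1 ≤ n → n ≤ M →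
        ∏ ℤₚ.+-*-commutativeRing cyclotomicValue (divisorsUpTo M n) ≡ A ℤ.^ n ℤ.- B ℤ.^ n
      ∏-cyclotomicValue n M 1≤n n≤M = ι-injective (begin
        ι (∏ ℤₚ.+-*-commutativeRing cyclotomicValue (divisorsUpTo M n))
          ≈⟨ ∏-natural commutativeRing ι-isRingHom cyclotomicValue (divisorsUpTo M n) ⟩
        ∏ commutativeRing (λ d → ι (cyclotomicValue d)) (divisorsUpTo M n)
          ≈⟨ ∏-cong commutativeRing (divisorsUpTo M n) (λ {d} d∈ → ι-cyclotomicValue d (divisor-positive d∈)) ⟩
        ∏ commutativeRing (λ d → ∏ commutativeRing (λ j → a - ω d ^ j * b) (totatives d)) (divisorsUpTo M n)
          ≈⟨ ∏-cyclotomic n M 1≤n n≤M a b ⟩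
        a ^ n - b ^ n                 ≈⟨ +-cong (ι-^ A n) (-‿cong (ι-^ B n)) ⟨
        ι (A ℤ.^ n) - ι (B ℤ.^ n)     ≈⟨ trans (ι.+-homo (A ℤ.^ n) (ℤ.- (B ℤ.^ n))) (+-congˡ (ι-neg (B ℤ.^ n))) ⟨
        ι (A ℤ.^ n ℤ.- B ℤ.^ n)       ∎)
        where
        divisor-positive : ∀ {d} → d ∈ divisorsUpTo M n → 1 ≤ d
        divisor-positive d∈ = proj₁ (∈[1⋯]⁻ (proj₁ (∈-filter⁻ (ℕ∣._∣? n) {xs = [1⋯ M ]} d∈)))

open ≡ using (refl; sym; trans; cong; cong₂; subst; subst₂; module ≡-Reasoning)

-- Prime divisors of the cyclotomic values

module Congruence (p : ℕ) where
  open import Data.Integer.Base using (_+_; _-_; _*_; -_; _^_)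

  infix 4 _≋_
  -- A record keeps x and y visible to unification; they could not be recovered from their
  -- difference.
  record _≋_ (x y : ℤ) : Set where
    constructor congruent
    field difference : + p ∣ x - y
  open _≋_ public

  ≋-reflexive : ∀ {x y} → x ≡ y → x ≋ y
  ≋-reflexive {x} refl = congruent (divides 0ℤ (ℤₚ.+-inverseʳ x))

  ≋-refl : ∀ {x} → x ≋ x
  ≋-refl = ≋-reflexive refl

  ≋-sym : ∀ {x y} → x ≋ y → y ≋ x
  ≋-sym {x} {y} (congruent p∣x-y) = congruent (subst (+ p ∣_) (identity x y) (∣m⇒∣-m p∣x-y))
    where
    identity : ∀ x y → - (x - y) ≡ y - x
    identity = solve-∀

  ≋-trans : ∀ {x y z} → x ≋ y → y ≋ z → x ≋ z
  ≋-trans {x} {y} {z} (congruent p∣x-y) (congruent p∣y-z) =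
    congruent (subst (+ p ∣_) (identity x y z) (∣m∣n⇒∣m+n p∣x-y p∣y-z))
    where
    identity : ∀ x y z → (x - y) + (y - z) ≡ x - z
    identity = solve-∀

  ≋-setoid : Setoid _ _
  ≋-setoid = record
    { _≈_ = _≋_
    ; isEquivalence = record { refl = ≋-refl ; sym = ≋-sym ; trans = ≋-trans }
    }

  ≋-+ : ∀ {x y z w} → x ≋ y → z ≋ w → x + z ≋ y + w
  ≋-+ {x} {y} {z} {w} (congruent p∣x-y) (congruent p∣z-w) =
    congruent (subst (+ p ∣_) (identity x y z w) (∣m∣n⇒∣m+n p∣x-y p∣z-w))
    where
    identity : ∀ x y z w → (x - y) + (z - w) ≡ (x + z) - (y + w)
    identity = solve-∀

  ≋-* : ∀ {x y z w} → x ≋ y → z ≋ w → x * z ≋ y * w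
  ≋-* {x} {y} {z} {w} (congruent p∣x-y) (congruent p∣z-w) =
    congruent (subst (+ p ∣_) (identity x y z w) (∣m∣n⇒∣m+n (∣m⇒∣m*n z p∣x-y) (∣n⇒∣m*n y p∣z-w)))
    where
    identity : ∀ x y z w → (x - y) * z + y * (z - w) ≡ x * z - y * w
    identity = solve-∀

  ≋-^ : ∀ {x y} n → x ≋ y → x ^ n ≋ y ^ n
  ≋-^ zero    x≋y = ≋-refl
  ≋-^ (suc n) x≋y = ≋-* x≋y (≋-^ n x≋y)

  ≋-∣ : ∀ {x y} → x ≋ y → + p ∣ x → + p ∣ y
  ≋-∣ {x} {y} (congruent p∣x-y) p∣x = subst (+ p ∣_) (identity x y) (∣m∣n⇒∣m-n p∣x p∣x-y)
    where
    identity : ∀ x y → x - (x - y) ≡ y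
    identity = solve-∀

  eval-≋ : ∀ {x y : ℤ} {a} {A : Set a} {ι κ : A → ℤ} (f : List A) → (∀ z → ι z ≋ κ z) → x ≋ y →
           eval ℤ.+-*-rawRing ι f x ≋ eval ℤ.+-*-rawRing κ f y
  eval-≋ []      ι≋κ x≋y = ≋-refl
  eval-≋ (z ∷ f) ι≋κ x≋y = ≋-+ (ι≋κ z) (≋-* x≋y (eval-≋ f ι≋κ x≋y))

  evalℤ[s,t]-≋ : ∀ P {s s′ t t′} → s ≋ s′ → t ≋ t′ → evalℤ[s,t] P s t ≋ evalℤ[s,t] P s′ t′
  evalℤ[s,t]-≋ P s≋s′ t≋t′ = eval-≋ P (λ f → eval-≋ f (λ z → ≋-refl {z}) s≋s′) t≋t′

  module _ .{{_ : NonZero p}} where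
    residue : ℤ → Fin p
    residue x = fromℕ< (n%ℕd<d x p)

    %-≋ : ∀ x → + (x %ℕ p) ≋ x
    %-≋ x = ≋-sym (congruent (divides (x /ℕ p) (trans
      (cong (_- + (x %ℕ p)) (a≡a%ℕn+[a/ℕn]*n x p))
      (identity (+ (x %ℕ p)) ((x /ℕ p) * + p)))))
      where
      identity : ∀ x y → x + y - x ≡ y
      identity = solve-∀

    residue-≋ : ∀ {x y} → residue x ≡ residue y → x ≋ y
    residue-≋ {x} {y} eq = ≋-trans (≋-sym (%-≋ x)) (≋-trans
      (≋-reflexive (cong +_ (fromℕ<-injective _ _ (n%ℕd<d x p) (n%ℕd<d y p) eq))) (%-≋ y))

prime-∣* : ∀ {p} → Prime p → ∀ x y → + p ∣ x ℤ.* y → + p ∣ x ⊎ + p ∣ y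
prime-∣* {p} p-prime x y p∣xy = Sum.map ∣ᵤ⇒∣ ∣ᵤ⇒∣
  (euclidsLemma ℤ.∣ x ∣ ℤ.∣ y ∣ p-prime (subst (p ℕ∣.∣_) (ℤₚ.abs-* x y) (∣⇒∣ᵤ p∣xy)))

prime-∤1 : ∀ {p} → Prime p → ¬ (+ p ∣ 1ℤ)
prime-∤1 p-prime p∣1 = ¬prime[1] (subst Prime (ℕ∣.∣1⇒≡1 (∣⇒∣ᵤ p∣1)) p-prime)

prime-∣^ : ∀ {p} → Prime p → ∀ x n → + p ∣ x ℤ.^ n → + p ∣ x
prime-∣^ p-prime x zero    p∣1   = contradiction p∣1 (prime-∤1 p-prime)
prime-∣^ p-prime x (suc n) p∣xxⁿ with prime-∣* p-prime x (x ℤ.^ n) p∣xxⁿ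
... | inj₁ p∣x  = p∣x
... | inj₂ p∣xⁿ = prime-∣^ p-prime x n p∣xⁿ

prime∤⇒coprime : ∀ {p e} → Prime p → ¬ (p ℕ∣.∣ e) → Coprime e p
prime∤⇒coprime p-prime p∤e (d∣e , d∣p) with prime⇒irreducible p-prime d∣p
... | inj₁ d≡1  = d≡1
... | inj₂ refl = contradiction d∣e p∤e

n<p^n : ∀ {p} → Prime p → ∀ n → n < p ℕ.^ n
n<p^n p-prime zero    = s≤s z≤n
n<p^n {p} p-prime (suc n) = begin-strict
  suc n                     ≤⟨ n<p^n p-prime n ⟩
  p ℕ.^ n                   <⟨ ℕₚ.m<m*n (p ℕ.^ n) p {{ℕₚ.m^n≢0 p n {{prime⇒nonZero p-prime}}}}
                                 (ℕ.nonTrivial⇒n>1 p {{prime⇒nonTrivial p-prime}}) ⟩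
  p ℕ.^ n ℕ.* p             ≡⟨ ℕₚ.*-comm _ p ⟩
  p ℕ.^ suc n               ∎
  where open ℕₚ.≤-Reasoning

∏ℤ : (ℕ → ℤ) → List ℕ → ℤ
∏ℤ = ∏ ℤₚ.+-*-commutativeRing

factor-∣∏ : ∀ (u : ℕ → ℤ) {d} xs → d ∈ xs → u d ∣ ∏ℤ u xs
factor-∣∏ u (x ∷ xs) (here refl) = ∣m⇒∣m*n _ (divides 1ℤ (sym (ℤₚ.*-identityˡ _)))
factor-∣∏ u (x ∷ xs) (there d∈)  = ∣n⇒∣m*n (u x) (factor-∣∏ u xs d∈)

prime-∣∏ : ∀ {p} → Prime p → ∀ (u : ℕ → ℤ) xs → + p ∣ ∏ℤ u xs → ∃[ d ] d ∈ xs × + p ∣ u d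
prime-∣∏ p-prime u []       p∣1 = contradiction p∣1 (prime-∤1 p-prime)
prime-∣∏ p-prime u (x ∷ xs) p∣∏ with prime-∣* p-prime (u x) (∏ℤ u xs) p∣∏
... | inj₁ p∣ux = x , here refl , p∣ux
... | inj₂ p∣∏xs with d , d∈ , p∣ud ← prime-∣∏ p-prime u xs p∣∏xs = d , there d∈ , p∣ud

newDivisor? : ∀ n m d → Dec (d ℕ∣.∣ m × ¬ (d ℕ∣.∣ n))
newDivisor? n m d = (d ℕ∣.∣? m) ×-dec ¬? (d ℕ∣.∣? n)

newDivisorsUpTo : ℕ → ℕ → ℕ → List ℕ
newDivisorsUpTo M n m = filter (newDivisor? n m) [1⋯ M ]

∏-newDivisors : ∀ {n m} → n ℕ∣.∣ m → ∀ u M →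
  ∏ℤ u (divisorsUpTo M m) ≡ ∏ℤ u (divisorsUpTo M n) ℤ.* ∏ℤ u (newDivisorsUpTo M n m)
∏-newDivisors {n} {m} n∣m u M = split [1⋯ M ]
  where
  open ≡-Reasoning
  split : ∀ xs → ∏ℤ u (filter (ℕ∣._∣? m) xs) ≡ ∏ℤ u (filter (ℕ∣._∣? n) xs) ℤ.* ∏ℤ u (filter (newDivisor? n m) xs)
  split [] = refl
  split (x ∷ xs) with x ℕ∣.∣? n | x ℕ∣.∣? m
  ... | yes _   | yes _   = trans (cong (u x ℤ.*_) (split xs))
    (sym (ℤₚ.*-assoc (u x) (∏ℤ u (filter (ℕ∣._∣? n) xs)) (∏ℤ u (filter (newDivisor? n m) xs))))
  ... | yes x∣n | no x∤m  = contradiction (ℕ∣.∣-trans x∣n n∣m) x∤m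
  ... | no _    | yes _   = trans (cong (u x ℤ.*_) (split xs))
    (identity (u x) (∏ℤ u (filter (ℕ∣._∣? n) xs)) (∏ℤ u (filter (newDivisor? n m) xs)))
    where
    identity : ∀ x y z → x ℤ.* (y ℤ.* z) ≡ y ℤ.* (x ℤ.* z)
    identity = solve-∀
  ... | no _    | no _    = split xs

-- The quotient (x^q - y^q) / (x - y), defined without division so that it keeps its meaning when x
-- and y agree modulo p.
geometric : ℤ → ℤ → ℕ → ℤ
geometric x y zero    = 0ℤ
geometric x y (suc q) = x ℤ.^ q ℤ.+ y ℤ.* geometric x y q

geometric-sum : ∀ x y q → (x ℤ.- y) ℤ.* geometric x y q ≡ x ℤ.^ q ℤ.- y ℤ.^ q
geometric-sum x y zero    = ℤₚ.*-zeroʳ (x ℤ.- y)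
geometric-sum x y (suc q) = begin
  (x ℤ.- y) ℤ.* (x ℤ.^ q ℤ.+ y ℤ.* geometric x y q)           ≡⟨ distribute x y (x ℤ.^ q) (geometric x y q) ⟩
  (x ℤ.- y) ℤ.* x ℤ.^ q ℤ.+ y ℤ.* ((x ℤ.- y) ℤ.* geometric x y q)
    ≡⟨ cong (λ z → (x ℤ.- y) ℤ.* x ℤ.^ q ℤ.+ y ℤ.* z) (geometric-sum x y q) ⟩
  (x ℤ.- y) ℤ.* x ℤ.^ q ℤ.+ y ℤ.* (x ℤ.^ q ℤ.- y ℤ.^ q)
    ≡⟨ telescope x y (x ℤ.^ q) (y ℤ.^ q) ⟩
  x ℤ.* x ℤ.^ q ℤ.- y ℤ.* y ℤ.^ q                             ∎
  where
  open ≡-Reasoning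
  distribute : ∀ x y z w → (x ℤ.- y) ℤ.* (z ℤ.+ y ℤ.* w) ≡ (x ℤ.- y) ℤ.* z ℤ.+ y ℤ.* ((x ℤ.- y) ℤ.* w)
  distribute = solve-∀
  telescope : ∀ x y z w → (x ℤ.- y) ℤ.* z ℤ.+ y ℤ.* (z ℤ.- w) ≡ x ℤ.* z ℤ.- y ℤ.* w
  telescope = solve-∀

module _ (p : ℕ) where
  open Congruence p
  open import Data.Integer.Base using (_+_; _-_; _*_; -_; _^_)

  -- Each of the `suc q` terms of the sum becomes x^q.
  geometric-≋ : ∀ {x y} → x ≋ y → ∀ q → geometric x y (suc q) ≋ + suc q * x ^ q
  geometric-≋ {x} {y} x≋y zero    = ≋-reflexive (cong (λ z → 1ℤ + z) (ℤₚ.*-zeroʳ y))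
  geometric-≋ {x} {y} x≋y (suc q) = begin
    x * x ^ q + y * geometric x y (suc q)   ≈⟨ ≋-+ (≋-refl {x * x ^ q}) (≋-* (≋-sym x≋y) (geometric-≋ x≋y q)) ⟩
    x * x ^ q + x * (+ suc q * x ^ q)       ≡⟨ identity x (x ^ q) (+ suc q) ⟩
    + suc (suc q) * (x * x ^ q)             ∎
    where
    open SetoidReasoning ≋-setoid
    identity : ∀ x y z → x * y + x * (z * y) ≡ (1ℤ + z) * (x * y)
    identity = solve-∀

  module _ (p-prime : Prime p) where
    private instance
      p≢0 : NonZero p
      p≢0 = prime⇒nonZero p-prime

    -- Two of the p + 1 powers of exponent 0, ..., p agree modulo p, and the smaller of them is
    -- prime to p and can be cancelled.
    multiplicative-order : ∀ x → ¬ (+ p ∣ x) → ∃[ n ] 1 ≤ n × x ^ n ≋ 1ℤ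
    multiplicative-order x p∤x
      with i , j , i<j , eq ← pigeonhole (ℕₚ.n<1+n p) (λ i → residue (x ^ toℕ i))
      = toℕ j ℕ.∸ toℕ i , ℕₚ.m<n⇒0<n∸m i<j , cancel
      where
      factored : x ^ toℕ j - x ^ toℕ i ≡ x ^ toℕ i * (x ^ (toℕ j ℕ.∸ toℕ i) - 1ℤ)
      factored = trans
        (cong (_- x ^ toℕ i) (trans (cong (x ^_) (sym (ℕₚ.m+[n∸m]≡n (ℕₚ.<⇒≤ i<j))))
          (ℤₚ.^-distribˡ-+-* x (toℕ i) (toℕ j ℕ.∸ toℕ i))))
        (identity (x ^ toℕ i) (x ^ (toℕ j ℕ.∸ toℕ i)))
        where
        identity : ∀ y z → y * z - y ≡ y * (z - 1ℤ)
        identity = solve-∀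
      cancel : x ^ (toℕ j ℕ.∸ toℕ i) ≋ 1ℤ
      cancel = Sum.[ (λ p∣xⁱ → contradiction (prime-∣^ p-prime x (toℕ i) p∣xⁱ) p∤x) , congruent ]′
        (prime-∣* p-prime (x ^ toℕ i) (x ^ (toℕ j ℕ.∸ toℕ i) - 1ℤ)
          (subst (+ p ∣_) factored (difference (≋-sym (residue-≋ {x ^ toℕ i} {x ^ toℕ j} eq)))))

    -- Zeros modulo p of a sequence whose divisor products are Aⁿ - Bⁿ.

    module _ (A B : ℤ) (p∤A : ¬ (+ p ∣ A)) (p∤B : ¬ (+ p ∣ B))
             (Aⁿ≢Bⁿ : ∀ n → 1 ≤ n → A ^ n - B ^ n ≢ 0ℤ) (u : ℕ → ℤ)
             (∏u : ∀ n M → 1 ≤ n → n ≤ M → ∏ℤ u (divisorsUpTo M n) ≡ A ^ n - B ^ n) where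

      u∣Aⁿ-Bⁿ : ∀ n → 1 ≤ n → u n ∣ A ^ n - B ^ n
      u∣Aⁿ-Bⁿ n 1≤n = subst (u n ∣_) (∏u n n 1≤n ℕₚ.≤-refl)
        (factor-∣∏ u (divisorsUpTo n n) (∈-filter⁺ (ℕ∣._∣? n) (∈[1⋯]⁺ 1≤n ℕₚ.≤-refl) ℕ∣.∣-refl))

      ∏-new-* : ∀ n m → 1 ≤ n → n ≤ m → n ℕ∣.∣ m → (A ^ n - B ^ n) * ∏ℤ u (newDivisorsUpTo m n m) ≡ A ^ m - B ^ m
      ∏-new-* n m 1≤n n≤m n∣m = trans (cong (_* ∏ℤ u (newDivisorsUpTo m n m)) (sym (∏u n m 1≤n n≤m)))
        (trans (sym (∏-newDivisors n∣m u m)) (∏u m m (ℕₚ.≤-trans 1≤n n≤m) ℕₚ.≤-refl))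

      geometric-power : ∀ n q → (A ^ n - B ^ n) * geometric (A ^ n) (B ^ n) q ≡ A ^ (n ℕ.* q) - B ^ (n ℕ.* q)
      geometric-power n q = trans (geometric-sum (A ^ n) (B ^ n) q) (cong₂ _-_ (ℤₚ.^-*-assoc A n q) (ℤₚ.^-*-assoc B n q))

      -- Both sides are the cofactor of Aⁿ - Bⁿ in A^(nq) - B^(nq). The cancellation takes place in
      -- ℤ, where Aⁿ - Bⁿ is nonzero although p may divide it.
      ∏-new : ∀ n q → 1 ≤ n → 1 ≤ q → ∏ℤ u (newDivisorsUpTo (n ℕ.* q) n (n ℕ.* q)) ≡ geometric (A ^ n) (B ^ n) q
      ∏-new n q 1≤n 1≤q = ℤₚ.*-cancelˡ-≡ (A ^ n - B ^ n)
        (∏ℤ u (newDivisorsUpTo (n ℕ.* q) n (n ℕ.* q))) (geometric (A ^ n) (B ^ n) q)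
        {{ℤ.≢-nonZero {A ^ n - B ^ n} (Aⁿ≢Bⁿ n 1≤n)}}
        (trans (∏-new-* n (n ℕ.* q) 1≤n (ℕₚ.m≤m*n n q {{>-nonZero 1≤q}}) (ℕ∣.m∣m*n q)) (sym (geometric-power n q)))

      -- The multiplier `suc (suc q)` is at least 2, which makes m a divisor of itself that does not
      -- divide n; thus `u m` divides the geometric sum. The zero at n enters as Aⁿ ≋ Bⁿ, which
      -- evaluates that sum modulo p.
      zeros-isolated : ∀ n q → 1 ≤ n → ¬ (p ℕ∣.∣ suc (suc q)) → + p ∣ u n → ¬ (+ p ∣ u (n ℕ.* suc (suc q)))
      zeros-isolated n q 1≤n p∤2+q p∣uₙ p∣uₘ = Sum.[ (λ p∣2+q → p∤2+q (∣⇒∣ᵤ p∣2+q))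
        , (λ p∣Aⁿ → p∤A (prime-∣^ p-prime A n (prime-∣^ p-prime (A ^ n) (suc q) p∣Aⁿ))) ]′
        (prime-∣* p-prime (+ suc (suc q)) ((A ^ n) ^ suc q) p∣[2+q]Aⁿ⁽¹⁺q⁾)
        where
        m = n ℕ.* suc (suc q)
        n<m : n < m
        n<m = ℕₚ.m<m*n n (suc (suc q)) {{>-nonZero 1≤n}} (s≤s (s≤s z≤n))
        m-new : m ∈ newDivisorsUpTo m n m
        m-new = ∈-filter⁺ (newDivisor? n m) (∈[1⋯]⁺ (ℕₚ.≤-trans 1≤n (ℕₚ.<⇒≤ n<m)) ℕₚ.≤-refl)
                  (ℕ∣.∣-refl , ℕ∣.>⇒∤ {{>-nonZero 1≤n}} n<m)
        p∣[2+q]Aⁿ⁽¹⁺q⁾ : + p ∣ + suc (suc q) * (A ^ n) ^ suc q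
        p∣[2+q]Aⁿ⁽¹⁺q⁾ = ≋-∣ {geometric (A ^ n) (B ^ n) (suc (suc q))}
          (geometric-≋ {A ^ n} {B ^ n} (congruent (∣-trans {+ p} {u n} p∣uₙ (u∣Aⁿ-Bⁿ n 1≤n))) (suc q))
          (subst (+ p ∣_) (∏-new n (suc (suc q)) 1≤n (s≤s z≤n))
            (∣-trans {+ p} {u m} p∣uₘ (factor-∣∏ u (newDivisorsUpTo m n m) m-new)))

      common-order : ∀ i j → A ^ i ≋ 1ℤ → B ^ j ≋ 1ℤ → A ^ (i ℕ.* j) ≋ B ^ (i ℕ.* j)
      common-order i j Aⁱ≋1 Bʲ≋1 = begin
        A ^ (i ℕ.* j)  ≡⟨ ℤₚ.^-*-assoc A i j ⟨
        (A ^ i) ^ j    ≈⟨ ≋-^ j Aⁱ≋1 ⟩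
        1ℤ ^ j         ≡⟨ trans (ℤₚ.^-zeroˡ j) (sym (ℤₚ.^-zeroˡ i)) ⟩
        1ℤ ^ i         ≈⟨ ≋-^ i Bʲ≋1 ⟨
        (B ^ j) ^ i    ≡⟨ trans (ℤₚ.^-*-assoc B j i) (cong (B ^_) (ℕₚ.*-comm j i)) ⟩
        B ^ (i ℕ.* j)  ∎
        where open SetoidReasoning ≋-setoid

      Aⁿ≋Bⁿ : ∃[ n ] 1 ≤ n × A ^ n ≋ B ^ n
      Aⁿ≋Bⁿ =
        let i , 1≤i , Aⁱ≋1 = multiplicative-order A p∤A
            j , 1≤j , Bʲ≋1 = multiplicative-order B p∤B
        in i ℕ.* j , ℕₚ.*-mono-≤ 1≤i 1≤j , common-order i j Aⁱ≋1 Bʲ≋1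

      large-zero : ∀ N n₀ → 1 ≤ n₀ → A ^ n₀ ≋ B ^ n₀ → ∃[ n ] N ≤ n × 2 ≤ n × + p ∣ u n
      large-zero N n₀ 1≤n₀ Aⁿ⁰≋Bⁿ⁰ = found (prime-∣∏ p-prime u (newDivisorsUpTo m n m) p∣∏new)
        where
        open SetoidReasoning ≋-setoid
        1≤p : 1 ≤ p
        1≤p = ℕ.>-nonZero⁻¹ p
        -- The power of p forces the zero to be large: a divisor of n₀ p^(N+1) that does not divide
        -- n₀ p^N is at least p^(N+1).
        n = n₀ ℕ.* p ℕ.^ N
        m = n ℕ.* p
        1≤n : 1 ≤ n
        1≤n = ℕₚ.*-mono-≤ 1≤n₀ (ℕₚ.m^n>0 p N)
        Aⁿ≋Bⁿ′ : A ^ n ≋ B ^ n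
        Aⁿ≋Bⁿ′ = begin
          A ^ n                    ≡⟨ ℤₚ.^-*-assoc A n₀ (p ℕ.^ N) ⟨
          (A ^ n₀) ^ (p ℕ.^ N)     ≈⟨ ≋-^ (p ℕ.^ N) Aⁿ⁰≋Bⁿ⁰ ⟩
          (B ^ n₀) ^ (p ℕ.^ N)     ≡⟨ ℤₚ.^-*-assoc B n₀ (p ℕ.^ N) ⟩
          B ^ n                    ∎
        -- The variable q stands for p so that it can be matched as a successor, the form in which
        -- `geometric-≋` counts the terms.
        p∣geometric : ∀ q → q ≡ p → + p ∣ geometric (A ^ n) (B ^ n) q
        p∣geometric zero    0≡p = contradiction 0≡p (ℕₚ.<⇒≢ 1≤p)
        p∣geometric (suc q) refl = ≋-∣ {+ suc q * (A ^ n) ^ q} (≋-sym (geometric-≋ Aⁿ≋Bⁿ′ q))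
          (∣m⇒∣m*n {m = + suc q} ((A ^ n) ^ q) (divides 1ℤ (sym (ℤₚ.*-identityˡ (+ suc q)))))
        p∣∏new : + p ∣ ∏ℤ u (newDivisorsUpTo m n m)
        p∣∏new = subst (+ p ∣_) (sym (∏-new n p 1≤n 1≤p)) (p∣geometric p refl)

        -- If n₀ pᴺ⁺¹ = e d and d ∤ n₀ pᴺ, then p ∤ e, so e divides n₀.
        large : ∀ d → d ℕ∣.∣ m → ¬ (d ℕ∣.∣ n) → p ℕ.^ suc N ≤ d
        large d (ℕ∣.divides e m≡ed) d∤n = ℕₚ.*-cancelˡ-≤ e {{e≢0}} (ℕₚ.≤-trans (ℕₚ.*-monoˡ-≤ (p ℕ.^ suc N) e≤n₀)
          (ℕₚ.≤-reflexive (trans (sym m≡n₀p) m≡ed)))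
          where
          m≡n₀p : m ≡ n₀ ℕ.* p ℕ.^ suc N
          m≡n₀p = trans (ℕₚ.*-assoc n₀ (p ℕ.^ N) p) (cong (n₀ ℕ.*_) (ℕₚ.*-comm (p ℕ.^ N) p))
          p∤e : ¬ (p ℕ∣.∣ e)
          p∤e (ℕ∣.divides f e≡fp) = d∤n (ℕ∣.divides f (ℕₚ.*-cancelʳ-≡ n (f ℕ.* d) p
            (trans m≡ed (trans (cong (ℕ._* d) e≡fp) (trans (ℕₚ.*-assoc f p d)
              (trans (cong (f ℕ.*_) (ℕₚ.*-comm p d)) (sym (ℕₚ.*-assoc f d p))))))))
          strip : ∀ k → e ℕ∣.∣ p ℕ.^ k ℕ.* n₀ → e ℕ∣.∣ n₀
          strip zero    e∣ = subst (e ℕ∣.∣_) (ℕₚ.*-identityˡ n₀) e∣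
          strip (suc k) e∣ = strip k (coprime-divisor {e} {p} (prime∤⇒coprime p-prime p∤e)
            (subst (e ℕ∣.∣_) (ℕₚ.*-assoc p (p ℕ.^ k) n₀) e∣))
          e≤n₀ : e ≤ n₀
          e≤n₀ = ℕ∣.∣⇒≤ {{>-nonZero 1≤n₀}} (strip (suc N) (ℕ∣.divides d
            (trans (ℕₚ.*-comm (p ℕ.^ suc N) n₀) (trans (sym m≡n₀p) (trans m≡ed (ℕₚ.*-comm e d))))))
          e≢0 : NonZero e
          e≢0 = ℕ.≢-nonZero λ e≡0 → ℕₚ.<⇒≢ (ℕₚ.*-mono-≤ 1≤n 1≤p) (sym (trans m≡ed (cong (ℕ._* d) e≡0)))

        found : ∃[ d ] d ∈ newDivisorsUpTo m n m × + p ∣ u d → ∃[ d ] N ≤ d × 2 ≤ d × + p ∣ u d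
        found (d , d∈ , p∣u) with _ , d∣m , d∤n ← ∈-filter⁻ (newDivisor? n m) {xs = [1⋯ m ]} d∈ =
          d , ℕₚ.≤-trans (ℕₚ.n≤1+n N) (ℕₚ.<⇒≤ big) , ℕₚ.≤-trans (s≤s (s≤s z≤n)) big , p∣u
          where
          -- The strict bound also gives 2 ≤ d and so avoids index 1, where the atom is normalised
          -- differently.
          big : suc N < d
          big = ℕₚ.<-≤-trans (n<p^n p-prime (suc N)) (large d d∣m d∤n)

      zeros-unbounded : ∀ N → ∃[ n ] N ≤ n × 2 ≤ n × + p ∣ u n
      zeros-unbounded N = let n₀ , 1≤n₀ , Aⁿ⁰≋Bⁿ⁰ = Aⁿ≋Bⁿ in large-zero N n₀ 1≤n₀ Aⁿ⁰≋Bⁿ⁰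

-- Recurrences modulo a prime

private
  toℚᵘ-ℤ→ℚ : ∀ a → toℚᵘ (ℤ→ℚ a) ℚᵘ.≃ mkℚᵘ a 0
  toℚᵘ-ℤ→ℚ a = ℚₚ.toℚᵘ-fromℚᵘ (mkℚᵘ a 0)

ℤ→ℚ-+ : ∀ a b → ℤ→ℚ (a ℤ.+ b) ≡ ℤ→ℚ a ℚ.+ ℤ→ℚ b
ℤ→ℚ-+ a b = ℚₚ.toℚᵘ-injective (begin
  toℚᵘ (ℤ→ℚ (a ℤ.+ b))                ≈⟨ toℚᵘ-ℤ→ℚ (a ℤ.+ b) ⟩
  mkℚᵘ (a ℤ.+ b) 0                    ≈⟨ *≡* (identity a b) ⟩
  mkℚᵘ a 0 ℚᵘ.+ mkℚᵘ b 0              ≈⟨ ℚᵘₚ.+-cong (toℚᵘ-ℤ→ℚ a) (toℚᵘ-ℤ→ℚ b) ⟨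
  toℚᵘ (ℤ→ℚ a) ℚᵘ.+ toℚᵘ (ℤ→ℚ b)      ≈⟨ ℚₚ.toℚᵘ-homo-+ (ℤ→ℚ a) (ℤ→ℚ b) ⟨
  toℚᵘ (ℤ→ℚ a ℚ.+ ℤ→ℚ b)              ∎)
  where
  open SetoidReasoning ℚᵘₚ.≃-setoid
  identity : ∀ a b → (a ℤ.+ b) ℤ.* 1ℤ ≡ (a ℤ.* 1ℤ ℤ.+ b ℤ.* 1ℤ) ℤ.* 1ℤ
  identity = solve-∀

ℤ→ℚ-* : ∀ a b → ℤ→ℚ (a ℤ.* b) ≡ ℤ→ℚ a ℚ.* ℤ→ℚ b
ℤ→ℚ-* a b = ℚₚ.toℚᵘ-injective (begin
  toℚᵘ (ℤ→ℚ (a ℤ.* b))                ≈⟨ toℚᵘ-ℤ→ℚ (a ℤ.* b) ⟩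
  mkℚᵘ a 0 ℚᵘ.* mkℚᵘ b 0              ≈⟨ ℚᵘₚ.*-cong (toℚᵘ-ℤ→ℚ a) (toℚᵘ-ℤ→ℚ b) ⟨
  toℚᵘ (ℤ→ℚ a) ℚᵘ.* toℚᵘ (ℤ→ℚ b)      ≈⟨ ℚₚ.toℚᵘ-homo-* (ℤ→ℚ a) (ℤ→ℚ b) ⟨
  toℚᵘ (ℤ→ℚ a ℚ.* ℤ→ℚ b)              ∎)
  where open SetoidReasoning ℚᵘₚ.≃-setoid

ℤ→ℚ-injective : ∀ {a b} → ℤ→ℚ a ≡ ℤ→ℚ b → a ≡ b
ℤ→ℚ-injective {a} {b} eq
  with *≡* a1≡b1 ← ℚᵘₚ.≃-trans (ℚᵘₚ.≃-sym (toℚᵘ-ℤ→ℚ a))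
         (ℚᵘₚ.≃-trans (ℚᵘₚ.≃-reflexive (cong toℚᵘ eq)) (toℚᵘ-ℤ→ℚ b)) =
  trans (sym (ℤₚ.*-identityʳ a)) (trans a1≡b1 (ℤₚ.*-identityʳ b))

denominator-* : ∀ q → ℤ→ℚ (↧ q) ℚ.* q ≡ ℤ→ℚ (↥ q)
denominator-* q = ℚₚ.toℚᵘ-injective (begin
  toℚᵘ (ℤ→ℚ (↧ q) ℚ.* q)              ≈⟨ ℚₚ.toℚᵘ-homo-* (ℤ→ℚ (↧ q)) q ⟩
  toℚᵘ (ℤ→ℚ (↧ q)) ℚᵘ.* toℚᵘ q        ≈⟨ ℚᵘₚ.*-congʳ {toℚᵘ q} (toℚᵘ-ℤ→ℚ (↧ q)) ⟩
  mkℚᵘ (↧ q) 0 ℚᵘ.* toℚᵘ q            ≈⟨ cleared q ⟩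
  mkℚᵘ (↥ q) 0                        ≈⟨ toℚᵘ-ℤ→ℚ (↥ q) ⟨
  toℚᵘ (ℤ→ℚ (↥ q))                    ∎)
  where
  open SetoidReasoning ℚᵘₚ.≃-setoid
  identity : ∀ a b → (a ℤ.* b) ℤ.* 1ℤ ≡ b ℤ.* (1ℤ ℤ.* a)
  identity = solve-∀
  cleared : ∀ q → mkℚᵘ (↧ q) 0 ℚᵘ.* toℚᵘ q ℚᵘ.≃ mkℚᵘ (↥ q) 0
  cleared q@record{} = *≡* (identity (↧ q) (↥ q))

-- The property of integer polynomials on which periodicity rests. It is stated for all moduli
-- because the prime is chosen only once the common denominator is known.
RespectsCongruences : (ℕ → ℤ) → Set
RespectsCongruences h = ∀ p {m n} → let open Congruence p in + m ≋ + n → h m ≋ h n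

ClearsDenominators : ℕ → (ℕ → ℚ) → (ℕ → ℤ) → Set
ClearsDenominators D e h = ∀ n → ℤ→ℚ (+ D) ℚ.* e n ≡ ℤ→ℚ (h n)

clear-* : ∀ {D e h} c → ClearsDenominators D e h → ClearsDenominators (c ℕ.* D) e (λ n → + c ℤ.* h n)
clear-* {D} {e} {h} c clears n = begin
  ℤ→ℚ (+ (c ℕ.* D)) ℚ.* e n           ≡⟨ cong (λ z → ℤ→ℚ z ℚ.* e n) (ℤₚ.pos-* c D) ⟩
  ℤ→ℚ (+ c ℤ.* + D) ℚ.* e n           ≡⟨ cong (ℚ._* e n) (ℤ→ℚ-* (+ c) (+ D)) ⟩
  ℤ→ℚ (+ c) ℚ.* ℤ→ℚ (+ D) ℚ.* e n     ≡⟨ ℚₚ.*-assoc (ℤ→ℚ (+ c)) (ℤ→ℚ (+ D)) (e n) ⟩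
  ℤ→ℚ (+ c) ℚ.* (ℤ→ℚ (+ D) ℚ.* e n)   ≡⟨ cong (ℤ→ℚ (+ c) ℚ.*_) (clears n) ⟩
  ℤ→ℚ (+ c) ℚ.* ℤ→ℚ (h n)             ≡⟨ ℤ→ℚ-* (+ c) (h n) ⟨
  ℤ→ℚ (+ c ℤ.* h n)                   ∎
  where open ≡-Reasoning

-- Horner's rule builds the multiplier as the product of the denominators of all coefficients; the
-- integer values `h′` follow the same recursion.
clear-polynomial : ∀ g → ∃[ D ] NonZero D × ∃[ h ]
  ClearsDenominators D (λ n → evalℚ[X] g (ℕ→ℚ n)) h × RespectsCongruences h
clear-polynomial [] = 1 , _ , (λ _ → + 0) , (λ n → ℚₚ.*-zeroʳ (ℤ→ℚ (+ 1))) , λ p _ → Congruence.≋-refl p {+ 0}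
clear-polynomial (c ∷ g) with D , D≢0 , h , clears , resp ← clear-polynomial g =
  ↧ₙ c ℕ.* D , ℕₚ.m*n≢0 (↧ₙ c) D {{_}} {{D≢0}} ,
  h′ , clears′ ,
  λ p m≋n → let open Congruence p in ≋-+ (≋-refl {↥ c ℤ.* + D}) (≋-* m≋n (≋-* (≋-refl {↧ c}) (resp p m≋n)))
  where
  open ≡-Reasoning
  expand : ∀ d D c x e → (d ℚ.* D) ℚ.* (c ℚ.+ x ℚ.* e) ≡ (d ℚ.* c) ℚ.* D ℚ.+ x ℚ.* (d ℚ.* (D ℚ.* e))
  expand = solve 5 (λ d D c x e → (d :* D) :* (c :+ x :* e) := (d :* c) :* D :+ x :* (d :* (D :* e))) refl
    where open +-*-Solver
  h′ : ℕ → ℤ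
  h′ n = ↥ c ℤ.* + D ℤ.+ + n ℤ.* (↧ c ℤ.* h n)
  clears′ : ClearsDenominators (↧ₙ c ℕ.* D) (λ n → evalℚ[X] (c ∷ g) (ℕ→ℚ n)) h′
  clears′ n = begin
    ℤ→ℚ (+ (↧ₙ c ℕ.* D)) ℚ.* (c ℚ.+ x ℚ.* e)
      ≡⟨ cong (λ z → ℤ→ℚ z ℚ.* (c ℚ.+ x ℚ.* e)) (ℤₚ.pos-* (↧ₙ c) D) ⟩
    ℤ→ℚ (↧ c ℤ.* + D) ℚ.* (c ℚ.+ x ℚ.* e)
      ≡⟨ cong (ℚ._* (c ℚ.+ x ℚ.* e)) (ℤ→ℚ-* (↧ c) (+ D)) ⟩
    (ℤ→ℚ (↧ c) ℚ.* ℤ→ℚ (+ D)) ℚ.* (c ℚ.+ x ℚ.* e)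
      ≡⟨ expand (ℤ→ℚ (↧ c)) (ℤ→ℚ (+ D)) c x e ⟩
    (ℤ→ℚ (↧ c) ℚ.* c) ℚ.* ℤ→ℚ (+ D) ℚ.+ x ℚ.* (ℤ→ℚ (↧ c) ℚ.* (ℤ→ℚ (+ D) ℚ.* e))
      ≡⟨ cong₂ (λ y z → y ℚ.* ℤ→ℚ (+ D) ℚ.+ x ℚ.* (ℤ→ℚ (↧ c) ℚ.* z)) (denominator-* c) (clears n) ⟩
    ℤ→ℚ (↥ c) ℚ.* ℤ→ℚ (+ D) ℚ.+ x ℚ.* (ℤ→ℚ (↧ c) ℚ.* ℤ→ℚ (h n))
      ≡⟨ cong₂ (λ y z → y ℚ.+ x ℚ.* z) (ℤ→ℚ-* (↥ c) (+ D)) (ℤ→ℚ-* (↧ c) (h n)) ⟨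
    ℤ→ℚ (↥ c ℤ.* + D) ℚ.+ x ℚ.* ℤ→ℚ (↧ c ℤ.* h n)
      ≡⟨ cong (ℤ→ℚ (↥ c ℤ.* + D) ℚ.+_) (ℤ→ℚ-* (+ n) (↧ c ℤ.* h n)) ⟨
    ℤ→ℚ (↥ c ℤ.* + D) ℚ.+ ℤ→ℚ (+ n ℤ.* (↧ c ℤ.* h n)) ≡⟨ ℤ→ℚ-+ (↥ c ℤ.* + D) _ ⟨
    ℤ→ℚ (↥ c ℤ.* + D ℤ.+ + n ℤ.* (↧ c ℤ.* h n))       ∎
    where
    x e : ℚ
    x = ℕ→ℚ n
    e = evalℚ[X] g x

clear-polynomials : ∀ k (G : Fin k → List ℚ) → ∃[ D ] NonZero D × Σ[ h ∈ (Fin k → ℕ → ℤ) ]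
  (∀ i → ClearsDenominators D (λ n → evalℚ[X] (G i) (ℕ→ℚ n)) (h i)) × (∀ i → RespectsCongruences (h i))
clear-polynomials ℕ.zero    G = 1 , _ , (λ ()) , (λ ()) , λ ()
clear-polynomials (suc k) G
  with D , D≢0 , h , clears , resp ← clear-polynomial (G zero)
  with E , E≢0 , hs , clearss , resps ← clear-polynomials k (λ i → G (suc i))
  = D ℕ.* E , ℕₚ.m*n≢0 D E {{D≢0}} {{E≢0}} ,
    (λ { zero n → + E ℤ.* h n ; (suc i) n → + D ℤ.* hs i n }) ,
    (λ { zero → subst (λ c → ClearsDenominators c (λ n → evalℚ[X] (G zero) (ℕ→ℚ n)) (λ n → + E ℤ.* h n)) (ℕₚ.*-comm E D)
           (clear-* {e = λ n → evalℚ[X] (G zero) (ℕ→ℚ n)} {h} E clears)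
       ; (suc i) → clear-* {e = λ n → evalℚ[X] (G (suc i)) (ℕ→ℚ n)} {hs i} D (clearss i) }) ,
    λ { zero p m≋n → let open Congruence p in ≋-* (≋-refl {+ E}) (resp p m≋n)
      ; (suc i) p m≋n → let open Congruence p in ≋-* (≋-refl {+ D}) (resps i p m≋n) }

∑ℤ : ∀ {l} → (Fin l → ℤ) → ℤ
∑ℤ = RawSemiringDefs.sum (RawRing.rawSemiring ℤ.+-*-rawRing)

∑ℚ : ∀ {l} → (Fin l → ℚ) → ℚ
∑ℚ = RawSemiringDefs.sum (RawRing.rawSemiring ℚ.+-*-rawRing)

clear-∑ : ∀ D l (e : Fin l → ℚ) (h v : Fin l → ℤ) → (∀ i → ℤ→ℚ (+ D) ℚ.* e i ≡ ℤ→ℚ (h i)) →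
          ℤ→ℚ (+ D) ℚ.* ∑ℚ (λ i → e i ℚ.* ℤ→ℚ (v i)) ≡ ℤ→ℚ (∑ℤ (λ i → h i ℤ.* v i))
clear-∑ D ℕ.zero  e h v clears = ℚₚ.*-zeroʳ (ℤ→ℚ (+ D))
clear-∑ D (suc l) e h v clears = begin
  D′ ℚ.* (e zero ℚ.* v₀ ℚ.+ rest)                  ≡⟨ ℚₚ.*-distribˡ-+ D′ (e zero ℚ.* v₀) rest ⟩
  D′ ℚ.* (e zero ℚ.* v₀) ℚ.+ D′ ℚ.* rest           ≡⟨ cong₂ ℚ._+_ (sym (ℚₚ.*-assoc D′ (e zero) v₀))
                                                       (clear-∑ D l (λ i → e (suc i)) (λ i → h (suc i)) (λ i → v (suc i)) (λ i → clears (suc i))) ⟩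
  D′ ℚ.* e zero ℚ.* v₀ ℚ.+ ℤ→ℚ rest′               ≡⟨ cong (λ z → z ℚ.* v₀ ℚ.+ ℤ→ℚ rest′) (clears zero) ⟩
  ℤ→ℚ (h zero) ℚ.* v₀ ℚ.+ ℤ→ℚ rest′                ≡⟨ cong (ℚ._+ ℤ→ℚ rest′) (ℤ→ℚ-* (h zero) (v zero)) ⟨
  ℤ→ℚ (h zero ℤ.* v zero) ℚ.+ ℤ→ℚ rest′            ≡⟨ ℤ→ℚ-+ (h zero ℤ.* v zero) rest′ ⟨
  ℤ→ℚ (h zero ℤ.* v zero ℤ.+ rest′)                ∎
  where
  open ≡-Reasoning
  D′ v₀ rest : ℚ
  D′ = ℤ→ℚ (+ D)
  v₀ = ℤ→ℚ (v zero)
  rest = ∑ℚ (λ i → e (suc i) ℚ.* ℤ→ℚ (v (suc i)))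
  rest′ : ℤ
  rest′ = ∑ℤ (λ i → h (suc i) ℤ.* v (suc i))

integral-recurrence : ∀ {D u l G n} {h : Fin (suc l) → ℕ → ℤ} →
  (∀ i → ClearsDenominators D (λ n → evalℚ[X] (G i) (ℕ→ℚ n)) (h i)) →
  ℤ→ℚ (u n) ≡ recurrenceRHS u l G n →
  + D ℤ.* u n ≡ h zero n ℤ.+ ∑ℤ (λ i → h (suc i) n ℤ.* u (n ℕ.∸ toℕ (suc i)))
integral-recurrence {D} {u} {l} {G} {n} {h} clears rec = ℤ→ℚ-injective (begin
  ℤ→ℚ (+ D ℤ.* u n)                                ≡⟨ ℤ→ℚ-* (+ D) (u n) ⟩
  ℤ→ℚ (+ D) ℚ.* ℤ→ℚ (u n)                          ≡⟨ cong (ℤ→ℚ (+ D) ℚ.*_) rec ⟩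
  ℤ→ℚ (+ D) ℚ.* recurrenceRHS u l G n              ≡⟨ ℚₚ.*-distribˡ-+ (ℤ→ℚ (+ D)) (e zero) rest ⟩
  ℤ→ℚ (+ D) ℚ.* e zero ℚ.+ ℤ→ℚ (+ D) ℚ.* rest      ≡⟨ cong₂ ℚ._+_ (clears zero n)
                                                       (clear-∑ D l (λ i → e (suc i)) (λ i → h (suc i) n) (λ i → u (n ℕ.∸ toℕ (suc i))) (λ i → clears (suc i) n)) ⟩
  ℤ→ℚ (h zero n) ℚ.+ ℤ→ℚ rest′                     ≡⟨ ℤ→ℚ-+ (h zero n) rest′ ⟨
  ℤ→ℚ (h zero n ℤ.+ rest′)                         ∎)
  where
  open ≡-Reasoning
  e : Fin (suc l) → ℚ
  e i = evalℚ[X] (G i) (ℕ→ℚ n)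
  rest : ℚ
  rest = ∑ℚ (λ i → e (suc i) ℚ.* ℤ→ℚ (u (n ℕ.∸ toℕ (suc i))))
  rest′ : ℤ
  rest′ = ∑ℤ (λ i → h (suc i) n ℤ.* u (n ℕ.∸ toℕ (suc i)))

-- Eventual periodicity modulo a prime that does not divide the common denominator.

module _ {p : ℕ} (p-prime : Prime p) where
  open Congruence p
  private instance
    p≢0 : NonZero p
    p≢0 = prime⇒nonZero p-prime

  ∑ℤ-≋ : ∀ {l} {v w : Fin l → ℤ} → (∀ i → v i ≋ w i) → ∑ℤ v ≋ ∑ℤ w
  ∑ℤ-≋ {ℕ.zero} v≋w = ≋-refl
  ∑ℤ-≋ {suc l}  v≋w = ≋-+ (v≋w zero) (∑ℤ-≋ (λ i → v≋w (suc i)))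

  ≋-cancel : ∀ {D x y} → ¬ (p ℕ∣.∣ D) → + D ℤ.* x ≋ + D ℤ.* y → x ≋ y
  ≋-cancel {D} {x} {y} p∤D (congruent p∣) with prime-∣* p-prime (+ D) (x ℤ.- y) (subst (+ p ∣_) (identity (+ D) x y) p∣)
    where
    identity : ∀ d x y → d ℤ.* x ℤ.- d ℤ.* y ≡ d ℤ.* (x ℤ.- y)
    identity = solve-∀
  ... | inj₁ p∣D   = contradiction (∣⇒∣ᵤ p∣D) p∤D
  ... | inj₂ p∣x-y = congruent p∣x-y

  -- The coefficients depend on n modulo p, so windows of l consecutive residues are sampled only at
  -- starting points in one residue class modulo p. There are p^l possible windows, so two of p^l +
  -- 1 samples coincide. From equal windows the recurrence, with D cancelled modulo p, produces
  -- equal continuations.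
  eventually-periodic : ∀ {D l} {h : Fin (suc l) → ℕ → ℤ} (u : ℕ → ℤ) N → ¬ (p ℕ∣.∣ D) →
    (∀ i → RespectsCongruences (h i)) →
    (∀ n → N ≤ n → l < n → + D ℤ.* u n ≡ h zero n ℤ.+ ∑ℤ (λ i → h (suc i) n ℤ.* u (n ℕ.∸ toℕ (suc i)))) →
    ∃[ T ] ∃[ M ] (∀ n → M ≤ n → u (n ℕ.+ T) ≋ u n) × 1 ≤ T
  eventually-periodic {D} {l} {h} u N p∤D resp rec
    with i , j , i<j , eq ← pigeonhole (ℕₚ.n<1+n (p ℕ.^ l))
           (λ k → funToFin (λ r → residue (u (suc N ℕ.+ toℕ k ℕ.* p ℕ.+ toℕ {l} r))))
    = T , b , periodic , ℕₚ.*-mono-≤ (ℕₚ.m<n⇒0<n∸m i<j) (ℕ.>-nonZero⁻¹ p)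
    where
    time : ℕ → ℕ
    -- The successor makes every starting point positive, so that the indices after the window
    -- exceed l strictly, as the recurrence requires.
    time k = suc N ℕ.+ k ℕ.* p
    b b′ T : ℕ
    b = time (toℕ i)
    b′ = time (toℕ j)
    T = (toℕ j ℕ.∸ toℕ i) ℕ.* p
    b′≡b+T : b′ ≡ b ℕ.+ T
    b′≡b+T = trans (cong time (sym (ℕₚ.m+[n∸m]≡n (ℕₚ.<⇒≤ i<j))))
      (trans (cong (suc N ℕ.+_) (ℕₚ.*-distribʳ-+ p (toℕ i) _)) (sym (ℕₚ.+-assoc (suc N) (toℕ i ℕ.* p) T)))
    initial : ∀ r → u (b ℕ.+ toℕ {l} r) ≋ u (b′ ℕ.+ toℕ r)
    initial r = residue-≋ (trans (sym (finToFun-funToFin _ r)) (trans (cong (λ s → finToFun s r) eq) (finToFun-funToFin _ r)))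
    b+r≋b′+r : ∀ r → + (b ℕ.+ r) ≋ + (b′ ℕ.+ r)
    b+r≋b′+r r = ≋-sym (congruent (divides (+ (toℕ j ℕ.∸ toℕ i)) (trans
      (cong (λ z → + (z ℕ.+ r) ℤ.- + (b ℕ.+ r)) b′≡b+T)
      (trans (identity (+ b) (+ T) (+ r)) (ℤₚ.pos-* (toℕ j ℕ.∸ toℕ i) p)))))
      where
      identity : ∀ b T r → b ℤ.+ T ℤ.+ r ℤ.- (b ℤ.+ r) ≡ T
      identity = solve-∀
    late : ∀ k r → l ≤ r → N ≤ time k ℕ.+ r × l < time k ℕ.+ r
    late k r l≤r =
      ℕₚ.≤-trans (ℕₚ.n≤1+n N) (ℕₚ.≤-trans (ℕₚ.m≤m+n (suc N) (k ℕ.* p)) (ℕₚ.m≤m+n (time k) r)) ,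
      ℕₚ.+-mono-≤ (s≤s (z≤n {N ℕ.+ k ℕ.* p})) l≤r
    agree : ∀ r → u (b ℕ.+ r) ≋ u (b′ ℕ.+ r)
    agree = <-rec _ step
      where
      step : ∀ r → (∀ {s} → s < r → u (b ℕ.+ s) ≋ u (b′ ℕ.+ s)) → u (b ℕ.+ r) ≋ u (b′ ℕ.+ r)
      step r ih with r ℕₚ.<? l
      ... | yes r<l = subst (λ s → u (b ℕ.+ s) ≋ u (b′ ℕ.+ s)) (toℕ-fromℕ< r<l) (initial (fromℕ< r<l))
      ... | no r≮l with N≤n , l<n ← late (toℕ i) r (ℕₚ.≮⇒≥ r≮l) | N≤n′ , l<n′ ← late (toℕ j) r (ℕₚ.≮⇒≥ r≮l) =
        ≋-cancel p∤D (≋-trans (≋-reflexive (rec (b ℕ.+ r) N≤n l<n)) (≋-trans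
          (≋-+ (resp zero p (b+r≋b′+r r)) (∑ℤ-≋ λ k → ≋-* (resp (suc k) p (b+r≋b′+r r)) (earlier k)))
          (≋-sym (≋-reflexive (rec (b′ ℕ.+ r) N≤n′ l<n′)))))
        where
        earlier : ∀ k → u (b ℕ.+ r ℕ.∸ toℕ (suc k)) ≋ u (b′ ℕ.+ r ℕ.∸ toℕ (suc k))
        earlier k = subst₂ (λ m n → u m ≋ u n) (sym (ℕₚ.+-∸-assoc b k<r)) (sym (ℕₚ.+-∸-assoc b′ k<r))
          (ih (ℕₚ.∸-monoʳ-< (s≤s z≤n) k<r))
          where
          k<r : toℕ (suc k) ≤ r
          k<r = ℕₚ.≤-trans (toℕ<n k) (ℕₚ.≮⇒≥ r≮l)
    periodic : ∀ n → b ≤ n → u (n ℕ.+ T) ≋ u n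
    periodic n b≤n = subst₂ (λ m m′ → u m ≋ u m′) shift (ℕₚ.m+[n∸m]≡n b≤n) (≋-sym (agree (n ℕ.∸ b)))
      where
      open ≡-Reasoning
      shift : b′ ℕ.+ (n ℕ.∸ b) ≡ n ℕ.+ T
      shift = begin
        b′ ℕ.+ (n ℕ.∸ b)       ≡⟨ cong (ℕ._+ (n ℕ.∸ b)) (trans b′≡b+T (ℕₚ.+-comm b T)) ⟩
        T ℕ.+ b ℕ.+ (n ℕ.∸ b)  ≡⟨ ℕₚ.+-assoc T b _ ⟩
        T ℕ.+ (b ℕ.+ (n ℕ.∸ b)) ≡⟨ cong (T ℕ.+_) (ℕₚ.m+[n∸m]≡n b≤n) ⟩
        T ℕ.+ n                ≡⟨ ℕₚ.+-comm T n ⟩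
        n ℕ.+ T                ∎

-- Choice of the prime

prime-divisor : ∀ n → 2 ≤ n → ∃[ p ] Prime p × p ℕ∣.∣ n
prime-divisor n@(suc _) 2≤n with factorise n
... | record { factors = []     ; isFactorisation = n≡1 } = contradiction (sym n≡1) (ℕₚ.<⇒≢ 2≤n)
... | record { factors = p ∷ ps ; isFactorisation = n≡p*ps ; factorsPrime = p-prime ∷ _ } =
  p , p-prime , subst (p ℕ∣.∣_) (sym n≡p*ps) (ℕ∣.m∣m*n _)

-- x = E t is a root of X² - s X - t modulo every divisor of E (E t - s) - 1,
-- and such divisors are coprime to E, a multiple of D t.
splitting-prime : ∀ D .{{_ : NonZero D}} s t → t ≢ 0ℤ →
  ∃[ p ] Prime p × ¬ (p ℕ∣.∣ D) × ¬ (+ p ∣ t) × ∃[ x ] + p ∣ ℤ.- (x ℤ.* (s ℤ.- x)) ℤ.- t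
splitting-prime D s t t≢0 =
  let p , p-prime , p∣∣c∣ = prime-divisor ℤ.∣ c ∣ 2≤∣c∣
      p∣c = ∣ᵤ⇒∣ {+ p} {c} p∣∣c∣
      p∤E p∣E = prime-∤1 p-prime (subst (+ p ∣_) (cancel (E ℤ.* Y))
        (∣m∣n⇒∣m-n {+ p} {E ℤ.* Y} {c} (∣m⇒∣m*n {+ p} {E} Y p∣E) p∣c))
  in p , p-prime ,
     (λ p∣D → p∤E (∣m⇒∣m*n {+ p} {+ D ℤ.* t} (+ m) (∣m⇒∣m*n {+ p} {+ D} t (∣ᵤ⇒∣ p∣D)))) ,
     (λ p∣t → p∤E (∣m⇒∣m*n {+ p} {+ D ℤ.* t} (+ m) (∣n⇒∣m*n {+ p} (+ D) {t} p∣t))) ,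
     E ℤ.* t , subst (+ p ∣_) (root-identity s t E) (∣n⇒∣m*n {+ p} t {c} p∣c)
  where
  m : ℕ
  -- This size gives |E| ≥ 3 and |E t| > |s|. Hence Y ≠ 0 and |c| ≥ |E| |Y| - 1 ≥ 2, so that c has a
  -- prime divisor.
  m = 3 ℕ.+ ℤ.∣ s ∣
  E Y c : ℤ
  E = + D ℤ.* t ℤ.* + m
  Y = E ℤ.* t ℤ.- s
  c = E ℤ.* Y ℤ.- 1ℤ
  cancel : ∀ x → x ℤ.- (x ℤ.- 1ℤ) ≡ 1ℤ
  cancel = solve-∀
  root-identity : ∀ s t E → t ℤ.* (E ℤ.* (E ℤ.* t ℤ.- s) ℤ.- 1ℤ) ≡ ℤ.- (E ℤ.* t ℤ.* (s ℤ.- E ℤ.* t)) ℤ.- t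
  root-identity = solve-∀
  1≤∣t∣ : 1 ≤ ℤ.∣ t ∣
  1≤∣t∣ = ℕₚ.n≢0⇒n>0 λ ∣t∣≡0 → t≢0 (ℤₚ.∣i∣≡0⇒i≡0 ∣t∣≡0)
  m≤∣E∣ : m ≤ ℤ.∣ E ∣
  m≤∣E∣ = begin
    m                          ≡⟨ ℕₚ.*-identityˡ m ⟨
    1 ℕ.* m                    ≤⟨ ℕₚ.*-monoˡ-≤ m (ℕₚ.*-mono-≤ (ℕ.>-nonZero⁻¹ D) 1≤∣t∣) ⟩
    D ℕ.* ℤ.∣ t ∣ ℕ.* m        ≡⟨ cong (ℕ._* m) (ℤₚ.abs-* (+ D) t) ⟨
    ℤ.∣ + D ℤ.* t ∣ ℕ.* m      ≡⟨ ℤₚ.abs-* (+ D ℤ.* t) (+ m) ⟨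
    ℤ.∣ E ∣                    ∎
    where open ℕₚ.≤-Reasoning
  ∣s∣<∣Et∣ : ℤ.∣ s ∣ < ℤ.∣ E ℤ.* t ∣
  ∣s∣<∣Et∣ = begin-strict
    ℤ.∣ s ∣                    <⟨ ℕₚ.m<n+m ℤ.∣ s ∣ (s≤s z≤n) ⟩
    m                          ≡⟨ ℕₚ.*-identityʳ m ⟨
    m ℕ.* 1                    ≤⟨ ℕₚ.*-mono-≤ m≤∣E∣ 1≤∣t∣ ⟩
    ℤ.∣ E ∣ ℕ.* ℤ.∣ t ∣        ≡⟨ ℤₚ.abs-* E t ⟨
    ℤ.∣ E ℤ.* t ∣              ∎
    where open ℕₚ.≤-Reasoning
  1≤∣Y∣ : 1 ≤ ℤ.∣ Y ∣
  1≤∣Y∣ = ℕₚ.n≢0⇒n>0 λ ∣Y∣≡0 → ℕₚ.<⇒≢ ∣s∣<∣Et∣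
    (cong ℤ.∣_∣ (sym (ℤₚ.i-j≡0⇒i≡j (E ℤ.* t) s (ℤₚ.∣i∣≡0⇒i≡0 ∣Y∣≡0))))
  2≤∣c∣ : 2 ≤ ℤ.∣ c ∣
  2≤∣c∣ = ℕₚ.+-cancelʳ-≤ 1 2 ℤ.∣ c ∣ (begin
    3                          ≤⟨ ℕₚ.≤-trans (ℕₚ.m≤m+n 3 ℤ.∣ s ∣) m≤∣E∣ ⟩
    ℤ.∣ E ∣                    ≡⟨ ℕₚ.*-identityʳ _ ⟨
    ℤ.∣ E ∣ ℕ.* 1              ≤⟨ ℕₚ.*-monoʳ-≤ ℤ.∣ E ∣ 1≤∣Y∣ ⟩
    ℤ.∣ E ∣ ℕ.* ℤ.∣ Y ∣        ≡⟨ ℤₚ.abs-* E Y ⟨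
    ℤ.∣ E ℤ.* Y ∣              ≡⟨ cong ℤ.∣_∣ (restore (E ℤ.* Y)) ⟨
    ℤ.∣ c ℤ.+ 1ℤ ∣             ≤⟨ ℤₚ.∣i+j∣≤∣i∣+∣j∣ c 1ℤ ⟩
    ℤ.∣ c ∣ ℕ.+ 1              ∎)
    where
    open ℕₚ.≤-Reasoning
    restore : ∀ x → x ℤ.- 1ℤ ℤ.+ 1ℤ ≡ x
    restore = solve-∀

pos-^ : ∀ a n → (+ a) ℤ.^ n ≡ + (a ℕ.^ n)
pos-^ a 0       = refl
pos-^ a (suc n) = trans (cong (+ a ℤ.*_) (pos-^ a n)) (sym (ℤₚ.pos-* a (a ℕ.^ n)))

powers-differ : ∀ {a b} → b < a → ∀ n → 1 ≤ n → (+ a) ℤ.^ n ℤ.- (+ b) ℤ.^ n ≢ 0ℤ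
powers-differ {a} {b} b<a n@(suc _) _ aⁿ-bⁿ≡0 = ℕₚ.<⇒≢ (ℕₚ.^-monoˡ-< n b<a)
  (ℤₚ.+-injective (trans (sym (pos-^ b n)) (trans (sym (ℤₚ.i-j≡0⇒i≡j ((+ a) ℤ.^ n) ((+ b) ℤ.^ n) aⁿ-bⁿ≡0)) (pos-^ a n))))

module _ {p : ℕ} (p-prime : Prime p) where
  open Congruence p
  private instance
    p≢0 : NonZero p
    p≢0 = prime⇒nonZero p-prime

  natural-roots : ∀ s t x → ¬ (+ p ∣ t) → + p ∣ ℤ.- (x ℤ.* (s ℤ.- x)) ℤ.- t →
    ∃[ a ] ∃[ b ] b < a × + a ℤ.+ + b ≋ s × ℤ.- (+ a ℤ.* + b) ≋ t × ¬ (+ p ∣ + a) × ¬ (+ p ∣ + b)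
  natural-roots s t x p∤t p∣ =
    a , b , ℕₚ.<-≤-trans (n%ℕd<d (s ℤ.- x) p) (ℕₚ.m≤n+m p _) , sum , product ,
    (λ p∣a → p∤t (≋-∣ product (neg (∣m⇒∣m*n {+ p} {+ a} (+ b) p∣a)))) ,
    (λ p∣b → p∤t (≋-∣ product (neg (∣n⇒∣m*n {+ p} (+ a) {+ b} p∣b))))
    where
    a b : ℕ
    -- The added p makes a exceed b, which is less than p, even if the two residues coincide.
    a = x %ℕ p ℕ.+ p
    b = (s ℤ.- x) %ℕ p
    neg : + p ∣ + a ℤ.* + b → + p ∣ ℤ.- (+ a ℤ.* + b)
    neg = ∣m⇒∣-m {+ p} {+ a ℤ.* + b}
    p≋0 : + p ≋ 0ℤ
    p≋0 = congruent (divides 1ℤ (trans (ℤₚ.+-identityʳ (+ p)) (sym (ℤₚ.*-identityˡ (+ p)))))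
    a≋x : + a ≋ x
    a≋x = ≋-trans (≋-+ (%-≋ x) p≋0) (≋-reflexive (ℤₚ.+-identityʳ x))
    b≋s-x : + b ≋ s ℤ.- x
    b≋s-x = %-≋ (s ℤ.- x)
    sum : + a ℤ.+ + b ≋ s
    sum = ≋-trans (≋-+ a≋x b≋s-x) (≋-reflexive (identity x s))
      where
      identity : ∀ x s → x ℤ.+ (s ℤ.- x) ≡ s
      identity = solve-∀
    product : ℤ.- (+ a ℤ.* + b) ≋ t
    product = begin
      ℤ.- (+ a ℤ.* + b)               ≡⟨ ℤₚ.-1*i≡-i (+ a ℤ.* + b) ⟨
      ℤ.-1ℤ ℤ.* (+ a ℤ.* + b)         ≈⟨ ≋-* (≋-refl {ℤ.-1ℤ}) (≋-* a≋x b≋s-x) ⟩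
      ℤ.-1ℤ ℤ.* (x ℤ.* (s ℤ.- x))     ≡⟨ ℤₚ.-1*i≡-i (x ℤ.* (s ℤ.- x)) ⟩
      ℤ.- (x ℤ.* (s ℤ.- x))           ≈⟨ congruent p∣ ⟩
      t                               ∎
      where open SetoidReasoning ≋-setoid

  -- Periodicity against the isolation of zeros.

  periodic-zeros : ∀ {u : ℕ → ℤ} {T M} → (∀ n → M ≤ n → u (n ℕ.+ T) ≋ u n) →
                   ∀ {n} → M ≤ n → + p ∣ u n → ∀ k → + p ∣ u (n ℕ.+ k ℕ.* T)
  periodic-zeros {u} periodic {n} M≤n p∣uₙ 0 = subst (λ m → + p ∣ u m) (sym (ℕₚ.+-identityʳ n)) p∣uₙ
  periodic-zeros {u} {T} periodic {n} M≤n p∣uₙ (suc k) = subst (λ m → + p ∣ u m) shift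
    (≋-∣ (≋-sym (periodic (n ℕ.+ k ℕ.* T) (ℕₚ.≤-trans M≤n (ℕₚ.m≤m+n n _)))) (periodic-zeros periodic M≤n p∣uₙ k))
    where
    shift : n ℕ.+ k ℕ.* T ℕ.+ T ≡ n ℕ.+ (T ℕ.+ k ℕ.* T)
    shift = trans (ℕₚ.+-assoc n (k ℕ.* T) T) (cong (n ℕ.+_) (ℕₚ.+-comm (k ℕ.* T) T))

  -- Two sequences are involved: `u`, taken at the lifted roots, has the exact product formula in ℤ,
  -- while `w`, taken at s and t, is the one that the recurrence makes periodic. Zeros pass between
  -- them modulo p from index 2 on.
  zeros-not-periodic : ∀ A B → ¬ (+ p ∣ A) → ¬ (+ p ∣ B) → (∀ n → 1 ≤ n → A ℤ.^ n ℤ.- B ℤ.^ n ≢ 0ℤ) →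
    (u : ℕ → ℤ) → (∀ n M → 1 ≤ n → n ≤ M → ∏ℤ u (divisorsUpTo M n) ≡ A ℤ.^ n ℤ.- B ℤ.^ n) →
    (w : ℕ → ℤ) → (∀ n → 2 ≤ n → u n ≋ w n) →
    ∀ T M → 1 ≤ T → ¬ (∀ n → M ≤ n → w (n ℕ.+ T) ≋ w n)
  zeros-not-periodic A B p∤A p∤B Aⁿ≢Bⁿ u ∏u w u≋w T M 1≤T periodic =
    let n , M≤n , 2≤n , p∣uₙ = zeros-unbounded p p-prime A B p∤A p∤B Aⁿ≢Bⁿ u ∏u M
    in absurd n M≤n 2≤n p∣uₙ (p ℕ.* T) refl
    where
    -- Since p T is positive it has the form `suc r`, and the multiplier 1 + p T becomes
    -- `suc (suc r)`, as `zeros-isolated` expects.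
    absurd : ∀ n → M ≤ n → 2 ≤ n → + p ∣ u n → ∀ r → ¬ (p ℕ.* T ≡ r)
    absurd n M≤n 2≤n p∣uₙ 0 pT≡0 = ℕₚ.<⇒≢ (ℕₚ.*-mono-≤ (ℕ.>-nonZero⁻¹ p) 1≤T) (sym pT≡0)
    absurd n M≤n 2≤n p∣uₙ (suc r) pT≡1+r =
      zeros-isolated p p-prime A B p∤A p∤B Aⁿ≢Bⁿ u ∏u n r (ℕₚ.<⇒≤ 2≤n) p∤2+r p∣uₙ
        (≋-∣ (≋-sym (u≋w (n ℕ.* suc (suc r)) (ℕₚ.≤-trans 2≤n (ℕₚ.m≤m*n n (suc (suc r))))))
          (subst (λ m → + p ∣ w m) shift (periodic-zeros periodic M≤n (≋-∣ (u≋w n 2≤n) p∣uₙ) (n ℕ.* p))))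
      where
      p∤2+r : ¬ (p ℕ∣.∣ suc (suc r))
      p∤2+r p∣2+r = ¬prime[1] (subst Prime (ℕ∣.∣1⇒≡1 (ℕ∣.∣m+n∣m⇒∣n
        (subst (p ℕ∣.∣_) (ℕₚ.+-comm 1 (suc r)) p∣2+r) (subst (p ℕ∣.∣_) pT≡1+r (ℕ∣.m∣m*n T)))) p-prime)
      shift : n ℕ.+ n ℕ.* p ℕ.* T ≡ n ℕ.* suc (suc r)
      shift = trans (cong (n ℕ.+_) (trans (ℕₚ.*-assoc n p T) (cong (n ℕ.*_) pT≡1+r))) (sym (ℕₚ.*-suc n (suc r)))

theorem24 :
    ∀ {c ℓ₁ ℓ₂} (K : HeytingField c ℓ₁ ℓ₂) → CharacteristicZero K →
    (ω : ℕ → HeytingField.Carrier K) → (∀ n → 1 ≤ n → IsPrimitiveRoot K n (ω n)) →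
    (P : ℕ → RawRing.Carrier ℤ[s,t]) → IsLucasAtoms K ω P →
    (s t : ℤ) → t ≢ 0ℤ →
    ¬ (∃[ l ] 1 ≤ l × (Σ[ G ∈ (Fin (suc l) → RawRing.Carrier ℚ[X]) ]
       ∃[ N ] (∀ n → N ≤ n → l < n →
         ℤ→ℚ (evalℤ[s,t] (P n) s t) ≡ recurrenceRHS (λ m → evalℤ[s,t] (P m) s t) l G n)))
theorem24 K char0 ω ω-primitive P atoms s t t≢0 (l , _ , G , N , recurrence) =
  let D , D≢0 , h , clears , resp = clear-polynomials (suc l) G
      p , p-prime , p∤D , p∤t , x , root = splitting-prime D {{D≢0}} s t t≢0
      a , b , b<a , a+b≋s , -ab≋t , p∤a , p∤b = natural-roots p-prime s t x p∤t root
      T , M , periodic , 1≤T = eventually-periodic p-prime {D} {l} {h} w N p∤D resp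
        (λ n N≤n l<n → integral-recurrence {D} {w} {l} {G} {n} {h} clears (recurrence n N≤n l<n))
      u = cyclotomicValue K ω ω-primitive char0 P atoms (+ a) (+ b)
      u≋w : ∀ n → 2 ≤ n → Congruence._≋_ p (u n) (w n)
      -- The match on the index lets `cyclotomicValue` reduce to the value of the atom, which it is
      -- away from index 1.
      u≋w = λ { (suc (suc n)) _ → Congruence.evalℤ[s,t]-≋ p (P (suc (suc n))) a+b≋s -ab≋t ; (suc 0) (s≤s ()) }
  in zeros-not-periodic p-prime (+ a) (+ b) p∤a p∤b (powers-differ b<a) u
       (∏-cyclotomicValue K ω ω-primitive char0 P atoms (+ a) (+ b)) w u≋w T M 1≤T periodic
  where
  w : ℕ → ℤ
  w n = evalℤ[s,t] (P n) s t
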